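{- Let $n\ge1$ and let $G=(V,E)$ and $H=(V,F)$ be graphs on the common node set $V=\{1,\dots,n\}$ such that the edges of $H$ are pairwise node-disjoint. Let $t=\lvert F\rvert$, $k=n-t$, and let $V=V_1\cup\dots\cup V_k$ be the decomposition of $V$ into the node sets of the connected components of $H$. Assume that $E$ consists of exactly $\binom{k}{2}$ edges, namely for each $1\le i<j\le k$ exactly one edge $e_{ij}$, which joins a node of $V_i$ and a node of $V_j$. Let $I(G,H)$ denote the inequality, in variables $x_{uv}$ indexed by the edges of the complete graph on $V\cup\{n+1\}$, \[ \sum_{uv\in E} T(u,v;n+1)-\sum_{uv\in F}T(u,v;n+1)+2\sum_{i:\,V_i=\{u\}}x_{u,n+1}\le 2, \] where $T(u,v;w)=x_{uv}-x_{uw}-x_{vw}$ and the last sum runs over the components $V_i$ consisting of a single node $u$. Assume $k\ge3$. Then $I(G,H)$ defines a facet of $\mathrm{CUT}^\square_{n+1}$ if and only if every node of $G$ has degree at least two in $G$.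
   Context: For a graph with node set $W$ and edge set $D$, the cut vector $\boldsymbol{\delta}(S)\in\mathbb{R}^D$ of $S\subseteq W$ has $\delta_{uv}(S)=1$ if exactly one of $u,v$ lies in $S$, and $0$ otherwise. $\mathrm{CUT}^\square_N$ is the cut polytope of $\mathrm{K}_N$: the convex hull of all cut vectors of subsets of the node set of $\mathrm{K}_N$, in $\mathbb{R}^{E(\mathrm{K}_N)}$; here the nodes of $\mathrm{K}_{n+1}$ are $V\cup\{n+1\}$. An inequality is a facet of a polytope $P$ if it is valid for $P$ and the set of points of $P$ satisfying it with equality has dimension $\dim P-1$.
   Formalization: The cut polytope is taken in rational rather than real coordinate space (rational points and rational convex weights), and validity and dimension are taken over the rationals. -}

module Defs where

open import Data.Nat as ℕ using (ℕ; zero; suc; _∸_)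
open import Data.Fin as F using (Fin; zero; suc; inject₁; fromℕ; _<?_; _≟_)
open import Data.Bool using (Bool; true; false; _∧_; _∨_; not; if_then_else_)
open import Data.Product using (Σ; ∃; _×_; _,_)
open import Data.Rational using (ℚ; 0ℚ; 1ℚ; _+_; _*_; _-_; _≤_)
open import Relation.Nullary using (¬_; yes; no; does)
open import Relation.Binary.PropositionalEquality using (_≡_)

sumFin : (m : ℕ) → (Fin m → ℚ) → ℚ
sumFin zero    f = 0ℚ
sumFin (suc m) f = f zero + sumFin m (λ i → f (suc i))

anyFin : (m : ℕ) → (Fin m → Bool) → Bool
anyFin zero    f = false
anyFin (suc m) f = f zero ∨ anyFin m (λ i → f (suc i))

allFin : (m : ℕ) → (Fin m → Bool) → Bool
allFin zero    f = true
allFin (suc m) f = f zero ∧ allFin m (λ i → f (suc i))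

countFin : (m : ℕ) → (Fin m → Bool) → ℕ
countFin zero    f = zero
countFin (suc m) f = (if f zero then 1 else 0) ℕ.+ countFin m (λ i → f (suc i))

sumℕ : (m : ℕ) → (Fin m → ℕ) → ℕ
sumℕ zero    f = zero
sumℕ (suc m) f = f zero ℕ.+ sumℕ m (λ i → f (suc i))

two : ℚ
two = 1ℚ + 1ℚ

eqᵇ : ∀ {m} → Fin m → Fin m → Bool
eqᵇ i j = does (i ≟ j)

ltᵇ : ∀ {m} → Fin m → Fin m → Bool
ltᵇ i j = does (i <? j)

-- Simple graphs on node set Fin n (node u ↔ paper's node toℕ u + 1)

record Graph (n : ℕ) : Set where
  field
    adj   : Fin n → Fin n → Bool
    sym   : ∀ u v → adj u v ≡ adj v u
    irrfl : ∀ u → adj u u ≡ false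
open Graph public

edgeCount : ∀ {n} → Graph n → ℕ
edgeCount {n} G = sumℕ n (λ u → countFin n (λ v → ltᵇ u v ∧ adj G u v))

degree : ∀ {n} → Graph n → Fin n → ℕ
degree {n} G u = countFin n (λ v → adj G u v)

reach : ∀ {n} → Graph n → ℕ → Fin n → Fin n → Bool
reach G zero    u v = eqᵇ u v
reach {n} G (suc k) u v = reach G k u v ∨ anyFin n (λ w → reach G k u w ∧ adj G w v)

-- u and v lie in the same connected component (a path has length < n)
SameComp : ∀ {n} → Graph n → Fin n → Fin n → Set
SameComp {n} G u v = reach G n u v ≡ true

singletonᵇ : ∀ {n} → Graph n → Fin n → Bool
singletonᵇ {n} G u = allFin n (λ v → not (reach G n u v) ∨ eqᵇ u v)

Matching : ∀ {n} → Graph n → Set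
Matching H = ∀ u v w → adj H u v ≡ true → adj H u w ≡ true → v ≡ w

kOf : ∀ {n} → Graph n → ℕ
kOf {n} H = n ∸ edgeCount H

EdgeCond : ∀ {n} → Graph n → Graph n → Set
EdgeCond {n} G H =
  (∀ u v → adj G u v ≡ true → ¬ SameComp H u v)
  × (∀ u v → ¬ SameComp H u v →
       Σ (Fin n) λ a → Σ (Fin n) λ b →
         SameComp H u a × SameComp H v b × adj G a b ≡ true)
  -- and at most one (as an unordered edge)
  × (∀ a b a' b' → adj G a b ≡ true → adj G a' b' ≡ true →
       (SameComp H a a' → SameComp H b b' → a ≡ a' × b ≡ b')
     × (SameComp H a b' → SameComp H b a' → a ≡ b' × b ≡ a'))

Edge : ℕ → Set
Edge N = Σ (Fin N) λ i → Σ (Fin N) λ j → i F.< j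

Vect : ℕ → Set
Vect N = Edge N → ℚ

-- x_{uv} for an unordered pair (0 if u = v, never used)
coord : ∀ {N} → Vect N → Fin N → Fin N → ℚ
coord x u v with u <? v | v <? u
... | yes p | _     = x (u , v , p)
... | no _  | yes q = x (v , u , q)
... | no _  | no _  = 0ℚ

sumEdges : (N : ℕ) → (Edge N → ℚ) → ℚ
sumEdges N f = sumFin N λ i → sumFin N λ j → g i j (i <? j)
  where
  g : (i j : Fin N) → _ → ℚ
  g i j (yes p) = f (i , j , p)
  g i j (no _)  = 0ℚ

Subset : ℕ → Set
Subset N = Fin N → Bool

xorᵇ : Bool → Bool → Bool
xorᵇ a b = if a then not b else b

cutVec : ∀ {N} → Subset N → Vect N
cutVec S (i , j , _) = if xorᵇ (S i) (S j) then 1ℚ else 0ℚ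

InCut : (N : ℕ) → Vect N → Set
InCut N x = Σ ℕ λ m → Σ (Fin m → Subset N) λ S → Σ (Fin m → ℚ) λ λs →
  (∀ i → 0ℚ ≤ λs i) × sumFin m λs ≡ 1ℚ ×
  (∀ e → x e ≡ sumFin m (λ i → λs i * cutVec (S i) e))

AffIndep : ∀ {N} (m : ℕ) → (Fin (suc m) → Vect N) → Set
AffIndep m p = ∀ (c : Fin m → ℚ) →
  (∀ e → sumFin m (λ i → c i * (p (suc i) e - p zero e)) ≡ 0ℚ) →
  ∀ i → c i ≡ 0ℚ

AffDim : ∀ {N} → (Vect N → Set) → ℕ → Set
AffDim {N} S d =
  (Σ (Fin (suc d) → Vect N) λ p → (∀ i → S (p i)) × AffIndep d p)
  × (∀ (p : Fin (suc (suc d)) → Vect N) → (∀ i → S (p i)) → ¬ AffIndep (suc d) p)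

Facet : ∀ {N} → (Vect N → Set) → (Vect N → ℚ) → ℚ → Set
Facet {N} P f b =
  (∀ x → P x → f x ≤ b)
  × Σ ℕ λ d → AffDim P (suc d) × AffDim (λ x → P x × f x ≡ b) d

-- The inequality I(G,H) on K_{n+1}; node n+1 is fromℕ n, V embedded by inject₁

T : ∀ {n} → Vect (suc n) → Fin n → Fin n → ℚ
T {n} x u v = coord x (inject₁ u) (inject₁ v)
            - coord x (inject₁ u) (fromℕ n) - coord x (inject₁ v) (fromℕ n)

sumGraphEdges : ∀ {n} → Graph n → (Fin n → Fin n → ℚ) → ℚ
sumGraphEdges {n} G f =
  sumFin n λ u → sumFin n λ v → if ltᵇ u v ∧ adj G u v then f u v else 0ℚ

lhsI : ∀ {n} → Graph n → Graph n → Vect (suc n) → ℚ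
lhsI {n} G H x =
  sumGraphEdges G (T x) - sumGraphEdges H (T x)
  + two * sumFin n (λ u → if singletonᵇ H u then coord x (inject₁ u) (fromℕ n) else 0ℚ)

{-# OPTIONS --safe #-}

-- Cuts are normalized so that node n+1 is outside the cut set R ⊆ V; then I(G,H) reads
-- m(R) ≤ 1 + e(R), where m(R) counts the components V_i ⊆ R and e(R) the edges of G inside R.
-- If V_i ⊆ R, the edges joining V_i to the other components inside R show validity, and
-- equality forces every edge of G inside R to run between components contained in R.
--
-- If a node u has degree at most one, then k ≥ 3 gives it a mate w, and one more linear equation
-- holds on the roots: R_w (1 - R_u) = 0 if u is isolated, and
-- R_w - R_w R_u - R_w R_x + R_u R_x = 0 if x is the only neighbour of u.
--
-- If all degrees are at least two, let a linear form vanish on the roots, and view it as a quadratic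
-- function φ of R with polar form β. The roots V_i, V_i ∪ V_j, V_i ∪ {w}, V_i ∪ V_j ∪ {w} and
-- V_i ∪ {w , w'} force φ and β to vanish on single nodes, hence the form to be zero. So as many
-- independent roots as there are edges can be chosen greedily.
module Submission where

open import Defs
open import Tactic.RingSolver.Core.AlmostCommutativeRing using (AlmostCommutativeRing; fromCommutativeRing)
open import Tactic.RingSolver using (solve-∀)
open import Data.Bool using (Bool; true; false; _∧_; _∨_; not; if_then_else_)
import Data.Bool.Properties as Boolₚ
open import Data.Bool.Properties using (∨-zeroʳ; ∨-comm; ∧-comm)
open import Data.Nat as ℕ using (ℕ; zero; suc; z≤n; s≤s; _≤_)
open import Data.Fin as F using (Fin; zero; suc; inject₁; fromℕ; punchIn; punchOut)
import Data.Fin.Properties as Fₚ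
import Data.Nat.Properties as ℕₚ
open import Data.Vec using (Vec; []; _∷_; lookup; tabulate)
open import Data.Vec.Properties using (lookup∘tabulate)
import Data.Fin.Subset.Properties as Subₚ
open import Function.Bundles using (_⇔_; mk⇔)
open import Data.Vec.Functional using (insertAt)
open import Data.Vec.Functional.Properties using (insertAt-lookup; insertAt-punchIn)
open import Data.Rational as ℚ using (ℚ; 0ℚ; 1ℚ; ½; _+_; _*_; _-_; -_; 1/_) renaming (_≤_ to _≤ℚ_)
import Data.Rational.Properties as ℚₚ
import Data.Fin.Relation.Unary.Top as Top
open import Data.Product using (Σ; ∃; _×_; _,_; proj₁; proj₂)
open import Data.Sum using (_⊎_; inj₁; inj₂; [_,_]′)
open import Data.Empty using (⊥-elim)
open import Relation.Nullary using (¬_; yes; no; Dec; does)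
open import Relation.Nullary.Decidable using (dec⇒maybe; ¬?; decidable-stable; dec-true; dec-false; from-no; _×-dec_; _⊎-dec_)
open import Relation.Binary.Definitions using (tri<; tri≈; tri>)
open import Relation.Binary.PropositionalEquality as ≡ using (_≡_; _≢_; refl; cong; cong₂; trans; subst; subst₂; module ≡-Reasoning)

-- A root that meets a two-node component only in `mate w` contains no neighbour of `mate w`, so
-- each of its full components is joined to that component at `w`. Information about `mate w`
-- therefore comes from the neighbours of `w`. One neighbour, in a component V_u, gives one equation
-- for two unknowns, φ(mate w) and β(V_u, mate w). A second neighbour lies in another component and
-- gives three equations for three unknowns, with only the zero solution; this is where degree two
-- enters. The dimension of the cut polytope is never computed beforehand. The cut of the empty set
-- lies off the hyperplane of the inequality, so adding it to independent points of the face raises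
-- the dimension by one. In one direction a single family of points thus settles both dimensions. In
-- the other, the extra equation has no constant term and so also holds at the empty cut; together
-- with the face this cut spans the polytope, and the equation would hold on every cut.

ℚ-ring : AlmostCommutativeRing _ _
ℚ-ring = fromCommutativeRing ℚₚ.+-*-commutativeRing (λ x → dec⇒maybe (0ℚ ℚₚ.≟ x))


-- Finite sums of rational numbers

sum-cong : ∀ m {f g : Fin m → ℚ} → (∀ i → f i ≡ g i) → sumFin m f ≡ sumFin m g
sum-cong zero    h = refl
sum-cong (suc m) h = cong₂ _+_ (h zero) (sum-cong m (λ i → h (suc i)))

sum-zero : ∀ m {f : Fin m → ℚ} → (∀ i → f i ≡ 0ℚ) → sumFin m f ≡ 0ℚ
sum-zero zero    h = refl
sum-zero (suc m) h rewrite h zero | sum-zero m (λ i → h (suc i)) = refl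

sum-+ : ∀ m (f g : Fin m → ℚ) → sumFin m (λ i → f i + g i) ≡ sumFin m f + sumFin m g
sum-+ zero    f g = refl
sum-+ (suc m) f g rewrite sum-+ m (λ i → f (suc i)) (λ i → g (suc i)) =
  shuffle (f zero) (g zero) (sumFin m (λ i → f (suc i))) (sumFin m (λ i → g (suc i)))
  where
  shuffle : ∀ a b c d → (a + b) + (c + d) ≡ (a + c) + (b + d)
  shuffle = solve-∀ ℚ-ring

sum-* : ∀ m c (f : Fin m → ℚ) → sumFin m (λ i → c * f i) ≡ c * sumFin m f
sum-* zero    c f = ≡.sym (ℚₚ.*-zeroʳ c)
sum-* (suc m) c f rewrite sum-* m c (λ i → f (suc i)) = ≡.sym (ℚₚ.*-distribˡ-+ c _ _)

sum-swap : ∀ m k (f : Fin m → Fin k → ℚ) →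
  sumFin m (λ i → sumFin k (f i)) ≡ sumFin k (λ j → sumFin m (λ i → f i j))
sum-swap zero    k f = ≡.sym (sum-zero k (λ _ → refl))
sum-swap (suc m) k f =
  trans (cong (sumFin k (f zero) +_) (sum-swap m k (λ i → f (suc i))))
        (≡.sym (sum-+ k (f zero) _))

sum-mono : ∀ m {f g : Fin m → ℚ} → (∀ i → f i ≤ℚ g i) → sumFin m f ≤ℚ sumFin m g
sum-mono zero    h = ℚₚ.≤-refl
sum-mono (suc m) h = ℚₚ.+-mono-≤ (h zero) (sum-mono m (λ i → h (suc i)))

sum-nonneg : ∀ m {f : Fin m → ℚ} → (∀ i → 0ℚ ≤ℚ f i) → 0ℚ ≤ℚ sumFin m f
sum-nonneg m {f} h = subst (_≤ℚ sumFin m f) (sum-zero m (λ _ → refl)) (sum-mono m h)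

sum-remove : ∀ {m} k (f : Fin (suc m) → ℚ) →
  sumFin (suc m) f ≡ f k + sumFin m (λ i → f (punchIn k i))
sum-remove zero f = refl
sum-remove {suc m} (suc k) f rewrite sum-remove k (λ i → f (suc i)) =
  shuffle (f zero) (f (suc k)) (sumFin m (λ i → f (suc (punchIn k i))))
  where
  shuffle : ∀ a b c → a + (b + c) ≡ b + (a + c)
  shuffle = solve-∀ ℚ-ring

sum-single : ∀ m (f : Fin m → ℚ) k → (∀ i → i ≢ k → f i ≡ 0ℚ) → sumFin m f ≡ f k
sum-single (suc m) f k h =
  trans (sum-remove k f)
  (trans (cong (f k +_) (sum-zero m (λ i → h (punchIn k i) (Fₚ.punchInᵢ≢i k i))))
         (ℚₚ.+-identityʳ (f k)))

-- Linear algebra over the rationals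

*-cancel-≡0 : ∀ x y → y ≢ 0ℚ → x * y ≡ 0ℚ → x ≡ 0ℚ
*-cancel-≡0 x y y≢0 xy≡0 = begin
  x                  ≡⟨ ℚₚ.*-identityʳ x ⟨
  x * 1ℚ             ≡⟨ cong (x *_) (ℚₚ.*-inverseʳ y) ⟨
  x * (y * 1/ y)     ≡⟨ ℚₚ.*-assoc x y (1/ y) ⟨
  x * y * 1/ y       ≡⟨ cong (_* 1/ y) xy≡0 ⟩
  0ℚ * 1/ y          ≡⟨ ℚₚ.*-zeroˡ (1/ y) ⟩
  0ℚ                 ∎
  where
  open ≡-Reasoning
  instance _ = ℚ.≢-nonZero y≢0

-- Elimination without division. A zero first row imposes no condition; otherwise a nonzero entry of
-- it is the pivot, its column is eliminated from the other rows, and the solution of the smaller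
-- system is multiplied by the pivot.
kernel : ∀ j M → j ℕ.< M → (A : Fin j → Fin M → ℚ) →
  Σ (Fin M → ℚ) λ a → (∃ λ k → a k ≢ 0ℚ) × (∀ i → sumFin M (λ k → a k * A i k) ≡ 0ℚ)
kernel zero    (suc M) _         A = (λ _ → 1ℚ) , (zero , λ ()) , λ ()
kernel (suc j) (suc M) (s≤s j<M) A with Fₚ.any? (λ k → ¬? (A zero k ℚₚ.≟ 0ℚ))
... | no zeroRow =
  let a , nz , h = kernel j (suc M) (ℕₚ.m≤n⇒m≤1+n j<M) (λ i → A (suc i)) in
  a , nz , λ where
    zero → sum-zero (suc M) λ k →
      trans (cong (a k *_) (decidable-stable (A zero k ℚₚ.≟ 0ℚ) (λ ne → zeroRow (k , ne))))
            (ℚₚ.*-zeroʳ (a k))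
    (suc i) → h i
... | yes (k , Ak≢0) = a , (punchIn k (proj₁ nz) , a≢0) , λ where
    zero    → trans (split (A zero)) (cancel₀ s (A zero k))
    (suc i) → trans (split (A (suc i))) (trans (≡.sym (combine i)) (h i))
  where
  A₀ = λ l → A zero (punchIn k l)
  B : Fin j → Fin M → ℚ
  B i l = A zero k * A (suc i) (punchIn k l) - A (suc i) k * A₀ l
  IH = kernel j M j<M B
  b  = proj₁ IH
  nz = proj₁ (proj₂ IH)
  h  = proj₂ (proj₂ IH)
  s = sumFin M (λ l → b l * A₀ l)
  -- The first row, after division by its pivot, forces the entry `- s` at `k`.
  a = insertAt (λ l → A zero k * b l) k (- s)
  a≢0 : a (punchIn k (proj₁ nz)) ≢ 0ℚ
  a≢0 a≡0 = Ak≢0 (*-cancel-≡0 _ _ (proj₂ nz)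
    (trans (≡.sym (insertAt-punchIn (λ l → A zero k * b l) k (- s) (proj₁ nz))) a≡0))
  split : ∀ (r : Fin (suc M) → ℚ) →
    sumFin (suc M) (λ l → a l * r l) ≡ - s * r k + A zero k * sumFin M (λ l → b l * r (punchIn k l))
  split r = trans (sum-remove k (λ l → a l * r l))
    (cong₂ _+_ (cong (_* r k) (insertAt-lookup _ k (- s)))
      (trans (sum-cong M (λ l → trans (cong (_* r (punchIn k l)) (insertAt-punchIn _ k (- s) l))
                                      (ℚₚ.*-assoc (A zero k) (b l) (r (punchIn k l)))))
             (sum-* M (A zero k) _)))
  cancel₀ : ∀ s x → - s * x + x * s ≡ 0ℚ
  cancel₀ = solve-∀ ℚ-ring
  distribute : ∀ x y b u v → b * (x * u - y * v) ≡ x * (b * u) + (- y) * (b * v)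
  distribute = solve-∀ ℚ-ring
  reorder : ∀ s y t → t + (- y) * s ≡ - s * y + t
  reorder = solve-∀ ℚ-ring
  combine : ∀ i → sumFin M (λ l → b l * B i l)
    ≡ - s * A (suc i) k + A zero k * sumFin M (λ l → b l * A (suc i) (punchIn k l))
  combine i = trans (sum-cong M (λ l → distribute (A zero k) (A (suc i) k) (b l) _ (A₀ l)))
    (trans (sum-+ M _ _)
    (trans (cong₂ _+_ (sum-* M (A zero k) _) (sum-* M (- A (suc i) k) _))
           (reorder s _ _)))

-- Vectors are functions, so `x` need only agree pointwise with the combination. The case m = 0 then
-- gives the value at zero, and m = 1 the invariance under pointwise equality.
IsLinear : ∀ {N} → (Vect N → ℚ) → Set
IsLinear {N} L = ∀ m (c : Fin m → ℚ) (v : Fin m → Vect N) (x : Vect N) →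
  (∀ e → x e ≡ sumFin m (λ i → c i * v i e)) → L x ≡ sumFin m (λ i → c i * L (v i))

module _ {N : ℕ} where

  linear-zero : IsLinear {N} (λ _ → 0ℚ)
  linear-zero m c v x h = ≡.sym (sum-zero m (λ i → ℚₚ.*-zeroʳ (c i)))

  linear-+ : ∀ {L K : Vect N → ℚ} → IsLinear L → IsLinear K → IsLinear (λ x → L x + K x)
  linear-+ hL hK m c v x h =
    trans (cong₂ _+_ (hL m c v x h) (hK m c v x h))
    (trans (≡.sym (sum-+ m _ _)) (sum-cong m (λ i → ≡.sym (ℚₚ.*-distribˡ-+ (c i) _ _))))

  linear-* : ∀ {L : Vect N → ℚ} r → IsLinear L → IsLinear (λ x → r * L x)
  linear-* r hL m c v x h =
    trans (cong (r *_) (hL m c v x h))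
    (trans (≡.sym (sum-* m r _)) (sum-cong m (λ i → shuffle r (c i) _)))
    where
    shuffle : ∀ r c l → r * (c * l) ≡ c * (r * l)
    shuffle = solve-∀ ℚ-ring

  linear-- : ∀ {L K : Vect N → ℚ} → IsLinear L → IsLinear K → IsLinear (λ x → L x - K x)
  linear-- {L} {K} hL hK m c v x h =
    trans (cong₂ _-_ (hL m c v x h) (hK m c v x h))
    (trans (cong (sumFin m _ +_) (neg-as-* _))
    (trans (cong (sumFin m _ +_) (≡.sym (sum-* m (- 1ℚ) _)))
    (trans (≡.sym (sum-+ m _ _)) (sum-cong m (λ i → factor (c i) _ _)))))
    where
    neg-as-* : ∀ x → - x ≡ - 1ℚ * x
    neg-as-* = solve-∀ ℚ-ring
    factor : ∀ c l k → c * l + - 1ℚ * (c * k) ≡ c * (l - k)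
    factor = solve-∀ ℚ-ring

  linear-sum : ∀ k {L : Fin k → Vect N → ℚ} → (∀ i → IsLinear (L i)) →
    IsLinear (λ x → sumFin k (λ i → L i x))
  linear-sum zero    h = linear-zero
  linear-sum (suc k) {L} h = linear-+ (h zero) (linear-sum k (λ i → h (suc i)))

  linear-if : ∀ b {L : Vect N → ℚ} → IsLinear L → IsLinear (λ x → if b then L x else 0ℚ)
  linear-if true  h = h
  linear-if false h = linear-zero

  linear-edge : ∀ (e : Edge N) → IsLinear (λ x → x e)
  linear-edge e m c v x h = h e

  linear-coord : ∀ (u v : Fin N) → IsLinear (λ x → coord x u v)
  linear-coord u v with u F.<? v | v F.<? u
  ... | yes p | _     = linear-edge (u , v , p)
  ... | no _  | yes q = linear-edge (v , u , q)
  ... | no _  | no _  = linear-zero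

  linear-null : ∀ {L : Vect N → ℚ} → IsLinear L → ∀ x → (∀ e → x e ≡ 0ℚ) → L x ≡ 0ℚ
  linear-null hL x h = hL 0 (λ ()) (λ ()) x h

  linear-combination : ∀ {L : Vect N → ℚ} → IsLinear L → ∀ a b c x y z w →
    (∀ e → w e ≡ a * x e + b * y e + c * z e) → L w ≡ a * L x + b * L y + c * L z
  linear-combination {L} hL a b c x y z w h =
    trans (hL 3 coeff vec w (λ e → trans (h e) (≡.sym (flatten (a * x e) (b * y e) (c * z e)))))
          (flatten (a * L x) (b * L y) (c * L z))
    where
    coeff : Fin 3 → ℚ
    coeff zero             = a
    coeff (suc zero)       = b
    coeff (suc (suc zero)) = c
    vec : Fin 3 → Vect N
    vec zero             = x
    vec (suc zero)       = y
    vec (suc (suc zero)) = z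
    flatten : ∀ p q r → p + (q + (r + 0ℚ)) ≡ p + q + r
    flatten = solve-∀ ℚ-ring

  linear-cong : ∀ {L : Vect N → ℚ} → IsLinear L → ∀ {x y} → (∀ e → x e ≡ y e) → L x ≡ L y
  linear-cong hL {x} {y} h =
    trans (hL 1 (λ _ → 1ℚ) (λ _ → y) x (λ e → trans (h e) (≡.sym (one _)))) (one _)
    where
    one : ∀ p → 1ℚ * p + 0ℚ ≡ p
    one = solve-∀ ℚ-ring

  linear-sub : ∀ {L : Vect N → ℚ} → IsLinear L → ∀ x y → L (λ e → x e - y e) ≡ L x - L y
  linear-sub {L} hL x y =
    trans (linear-combination hL 1ℚ (- 1ℚ) 0ℚ x y y _ (λ e → ≡.sym (simplify (x e) (y e))))
          (simplify (L x) (L y))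
    where
    simplify : ∀ p q → 1ℚ * p + - 1ℚ * q + 0ℚ * q ≡ p - q
    simplify = solve-∀ ℚ-ring

  -- The new point goes second because `AffIndep` takes differences from the point at `zero`, which
  -- thus stays the base point.
  insertPoint : ∀ {d} → Vect N → (Fin (suc d) → Vect N) → Fin (suc (suc d)) → Vect N
  insertPoint q p zero          = p zero
  insertPoint q p (suc zero)    = q
  insertPoint q p (suc (suc i)) = p (suc i)

  insertPoint-elim : ∀ {d} (P : Vect N → Set) {q p} → P q → (∀ i → P (p i)) →
    ∀ i → P (insertPoint {d} q p i)
  insertPoint-elim P hq hp zero          = hp zero
  insertPoint-elim P hq hp (suc zero)    = hq
  insertPoint-elim P hq hp (suc (suc i)) = hp (suc i)

  -- Applying L to an affine dependency leaves only the coefficient of the new point.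
  affIndep-insert : ∀ {L : Vect N → ℚ} → IsLinear L → ∀ {d} (p : Fin (suc d) → Vect N) q k →
    AffIndep d p → (∀ i → L (p i) ≡ k) → L q ≢ k → AffIndep (suc d) (insertPoint q p)
  affIndep-insert {L} hL {d} p q k indep Lp Lq c h = λ where
      zero    → c₀≡0
      (suc i) → indep (λ i → c (suc i)) rest i
    where
    v : Fin (suc d) → Vect N
    v i e = insertPoint q p (suc i) e - p zero e
    Lv-zero : L (v zero) ≡ L q - k
    Lv-zero = trans (linear-sub hL q (p zero)) (cong (λ z → L q - z) (Lp zero))
    Lv-suc : ∀ i → L (v (suc i)) ≡ 0ℚ
    Lv-suc i = trans (linear-sub hL (p (suc i)) (p zero))
      (trans (cong₂ _-_ (Lp (suc i)) (Lp zero)) (ℚₚ.+-inverseʳ k))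
    Lsum : sumFin (suc d) (λ i → c i * L (v i)) ≡ 0ℚ
    Lsum = trans (≡.sym (hL (suc d) c v (λ _ → 0ℚ) (λ e → ≡.sym (h e)))) (linear-null hL _ (λ _ → refl))
    c₀Lq : c zero * (L q - k) ≡ 0ℚ
    c₀Lq = trans (≡.sym (ℚₚ.+-identityʳ _)) (trans (cong₂ _+_ (cong (c zero *_) (≡.sym Lv-zero))
      (≡.sym (sum-zero d (λ i → trans (cong (c (suc i) *_) (Lv-suc i)) (ℚₚ.*-zeroʳ (c (suc i)))))))
      Lsum)
    c₀≡0 : c zero ≡ 0ℚ
    c₀≡0 = *-cancel-≡0 _ _ (λ eq → Lq (trans (recover (L q) k) (trans (cong (_+ k) eq) (ℚₚ.+-identityˡ k)))) c₀Lq
      where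
      recover : ∀ x y → x ≡ x - y + y
      recover = solve-∀ ℚ-ring
    rest : ∀ e → sumFin d (λ i → c (suc i) * (p (suc i) e - p zero e)) ≡ 0ℚ
    rest e = trans (≡.sym (drop c₀≡0 (q e - p zero e) (sumFin d (λ i → c (suc i) * (p (suc i) e - p zero e))))) (h e)
      where
      drop : ∀ {a} → a ≡ 0ℚ → ∀ b s → a * b + s ≡ s
      drop refl b s = trans (cong (_+ s) (ℚₚ.*-zeroˡ b)) (ℚₚ.+-identityˡ s)

-- An enumeration of the N choose 2 edges of the complete graph

edgeSize : ℕ → ℕ
edgeSize zero    = zero
edgeSize (suc N) = N ℕ.+ edgeSize N

edgeFromZero : ∀ {N} → Fin N → Edge (suc N)
edgeFromZero j = zero , suc j , s≤s z≤n

edgeSuc : ∀ {N} → Edge N → Edge (suc N)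
edgeSuc (i , j , p) = suc i , suc j , s≤s p

edgeAt : ∀ N → Fin (edgeSize N) → Edge N
edgeAt (suc N) k = [ edgeFromZero , (λ l → edgeSuc (edgeAt N l)) ]′ (F.splitAt N k)

edgeIndex : ∀ {N} → Edge N → Fin (edgeSize N)
edgeIndex {suc N} (zero  , suc j , _)     = j F.↑ˡ edgeSize N
edgeIndex {suc N} (suc i , suc j , s≤s p) = N F.↑ʳ edgeIndex (i , j , p)

edgeAt-index : ∀ {N} (e : Edge N) → edgeAt N (edgeIndex e) ≡ e
edgeAt-index {suc N} (zero  , suc j , s≤s z≤n)
  rewrite Fₚ.splitAt-↑ˡ N j (edgeSize N) = refl
edgeAt-index {suc N} (suc i , suc j , s≤s p)
  rewrite Fₚ.splitAt-↑ʳ N (edgeSize N) (edgeIndex (i , j , p)) = cong edgeSuc (edgeAt-index (i , j , p))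

edgeIndex-at : ∀ N k → edgeIndex (edgeAt N k) ≡ k
edgeIndex-at (suc N) k with F.splitAt N k in eq
... | inj₁ j = Fₚ.splitAt⁻¹-↑ˡ eq
... | inj₂ l = trans (cong (N F.↑ʳ_) (edgeIndex-at N l)) (Fₚ.splitAt⁻¹-↑ʳ eq)

-- Linear forms, independent points and facets

module _ {N : ℕ} where

  form : (Fin (edgeSize N) → ℚ) → Vect N → ℚ
  form a x = sumFin (edgeSize N) (λ k → a k * x (edgeAt N k))

  form-linear : ∀ a → IsLinear (form a)
  form-linear a = linear-sum (edgeSize N) (λ k → linear-* (a k) (linear-edge (edgeAt N k)))

  form-single : ∀ a (x : Vect N) e → (∀ e′ → e′ ≢ e → a (edgeIndex e′) * x e′ ≡ 0ℚ) →
    form a x ≡ a (edgeIndex e) * x e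
  form-single a x e h =
    trans (sum-single (edgeSize N) _ (edgeIndex e) off)
          (cong (λ e′ → a (edgeIndex e) * x e′) (edgeAt-index e))
    where
    off : ∀ k → k ≢ edgeIndex e → a k * x (edgeAt N k) ≡ 0ℚ
    off k k≢ = trans (cong (λ l → a l * x (edgeAt N k)) (≡.sym (edgeIndex-at N k)))
      (h (edgeAt N k) (λ eq → k≢ (trans (≡.sym (edgeIndex-at N k)) (cong edgeIndex eq))))

  -- There is one more difference vector than there are coordinates, so `kernel`, with edges as rows
  -- and points as columns, yields a dependency.
  affIndep-bound : (p : Fin (suc (suc (edgeSize N))) → Vect N) → ¬ AffIndep (suc (edgeSize N)) p
  affIndep-bound p indep =
    let c , (k , ck≢0) , h = kernel (edgeSize N) (suc (edgeSize N)) ℕₚ.≤-refl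
                               (λ i k → p (suc k) (edgeAt N i) - p zero (edgeAt N i))
    in ck≢0 (indep c (λ e → subst (λ e → sumFin _ (λ k → c k * (p (suc k) e - p zero e)) ≡ 0ℚ)
                               (edgeAt-index e) (h (edgeIndex e))) k)

  -- Greedy choice: fewer points than edges leave a nonzero form that vanishes at all of them, and a
  -- point of `R` off the zero set of this form is affinely independent of them.
  affIndep-extract : (R : Vect N → Set) →
    (∀ a → (∃ λ k → a k ≢ 0ℚ) → Σ (Vect N) λ q → R q × form a q ≢ 0ℚ) →
    ∀ d → suc d ≤ edgeSize N →
    Σ (Fin (suc d) → Vect N) λ p → (∀ i → R (p i)) × AffIndep d p
  affIndep-extract R sep zero 1≤M =
    let a , nz , _ = kernel 0 (edgeSize N) 1≤M (λ ())
        q , Rq , _ = sep a nz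
    in (λ _ → q) , (λ _ → Rq) , λ _ _ ()
  affIndep-extract R sep (suc d) d<M =
    let p , Rp , indep = affIndep-extract R sep d (ℕₚ.<⇒≤ d<M)
        a , nz , h     = kernel (suc d) (edgeSize N) d<M (λ i k → p i (edgeAt N k))
        q , Rq , aq≢0  = sep a nz
    in insertPoint q p , insertPoint-elim R Rq Rp
     , affIndep-insert (form-linear a) p q 0ℚ indep h aq≢0

  -- The face contains as many independent points as there are edges, and `z` adds one more for the
  -- polytope. Both families are maximal by the number of coordinates; for the face this is seen
  -- after inserting `z`.
  facet-criterion : ∀ {P : Vect N → Set} {f : Vect N → ℚ} {b} → IsLinear f → 1 ≤ edgeSize N →
    (∀ x → P x → f x ≤ℚ b) → (z : Vect N) → P z → f z ≢ b →
    (∀ a → (∃ λ k → a k ≢ 0ℚ) → Σ (Vect N) λ q → (P q × f q ≡ b) × form a q ≢ 0ℚ) →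
    Facet P f b
  facet-criterion {P} {f} {b} hf 1≤M valid z Pz fz≢b sep = valid , facet (edgeSize N) refl 1≤M
    where
    Face : Vect N → Set
    Face x = P x × f x ≡ b
    extend : ∀ {d} (p : Fin (suc d) → Vect N) → (∀ i → Face (p i)) → AffIndep d p →
      AffIndep (suc d) (insertPoint z p)
    extend p Fp indep = affIndep-insert hf p z b indep (λ i → proj₂ (Fp i)) fz≢b
    -- `M` replaces `edgeSize N` so that it can be matched as `suc d`.
    facet : ∀ M → M ≡ edgeSize N → 1 ≤ M →
      Σ ℕ λ d → AffDim P (suc d) × AffDim Face d
    facet (suc d) refl≡ _ = d
      , ((insertPoint z p , insertPoint-elim P Pz (λ i → proj₁ (Fp i)) , extend p Fp indep)
        , λ p′ _ → bound p′)
      , ((p , Fp , indep)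
        , λ p′ Fp′ indep′ → bound (insertPoint z p′) (extend p′ Fp′ indep′))
      where
      basis = affIndep-extract Face sep d (ℕₚ.≤-reflexive refl≡)
      p     = proj₁ basis
      Fp    = proj₁ (proj₂ basis)
      indep = proj₂ (proj₂ basis)
      bound : (p : Fin (suc (suc (suc d))) → Vect N) → ¬ AffIndep (suc (suc d)) p
      bound = subst (λ M → (p : Fin (suc (suc M)) → Vect N) → ¬ AffIndep (suc M) p)
                (≡.sym refl≡) affIndep-bound

  -- If L q were nonzero, d + 1 independent points of the face, then `z`, then `q` would make d + 3
  -- independent points in a polytope of dimension d + 1.
  facet-unique-form : ∀ {P : Vect N → Set} {f L : Vect N → ℚ} {b} → IsLinear f → IsLinear L →
    Facet P f b → (∀ x → P x → f x ≡ b → L x ≡ 0ℚ) →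
    (z : Vect N) → P z → f z ≢ b → L z ≡ 0ℚ →
    ∀ q → P q → L q ≡ 0ℚ
  facet-unique-form {P} {L = L} {b} hf hL (_ , d , (_ , maximal) , ((p , Fp , indep) , _)) vanish z Pz fz≢b Lz≡0 q Pq =
    decidable-stable (L q ℚₚ.≟ 0ℚ) λ Lq≢0 →
      maximal (insertPoint q (insertPoint z p))
        (insertPoint-elim P Pq Pzp)
        (affIndep-insert hL (insertPoint z p) q 0ℚ
          (affIndep-insert hf p z b indep (λ i → proj₂ (Fp i)) fz≢b)
          (insertPoint-elim (λ x → L x ≡ 0ℚ) Lz≡0 (λ i → vanish (p i) (proj₁ (Fp i)) (proj₂ (Fp i))))
          Lq≢0)
    where
    Pzp = insertPoint-elim P Pz (λ i → proj₁ (Fp i))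

-- From cut vectors to the cut polytope

sum-nonneg-null : ∀ m {f : Fin m → ℚ} → (∀ i → 0ℚ ≤ℚ f i) → sumFin m f ≡ 0ℚ → ∀ i → f i ≡ 0ℚ
sum-nonneg-null (suc m) {f} f≥0 h i = ℚₚ.≤-antisym fi≤0 (f≥0 i)
  where
  fi≤0 : f i ≤ℚ 0ℚ
  fi≤0 = begin
    f i                                        ≡⟨ ℚₚ.+-identityʳ (f i) ⟨
    f i + 0ℚ                                   ≤⟨ ℚₚ.+-monoʳ-≤ (f i) (sum-nonneg m (λ j → f≥0 (punchIn i j))) ⟩
    f i + sumFin m (λ j → f (punchIn i j))     ≡⟨ sum-remove i f ⟨
    sumFin (suc m) f                           ≡⟨ h ⟩
    0ℚ                                         ∎
    where open ℚₚ.≤-Reasoning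

0≤-* : ∀ {x y} → 0ℚ ≤ℚ x → 0ℚ ≤ℚ y → 0ℚ ≤ℚ x * y
0≤-* {x} {y} 0≤x 0≤y = subst (_≤ℚ x * y) (ℚₚ.*-zeroʳ x) (ℚₚ.*-monoˡ-≤-nonNeg x 0≤y)
  where instance _ = ℚ.nonNegative 0≤x

0≤-- : ∀ {x y} → x ≤ℚ y → 0ℚ ≤ℚ y - x
0≤-- {x} {y} x≤y = subst (_≤ℚ y - x) (ℚₚ.+-inverseʳ x) (ℚₚ.+-monoˡ-≤ (- x) x≤y)

module _ {N : ℕ} where

  cutVec-inCut : (S : Subset N) → InCut N (cutVec S)
  cutVec-inCut S = 1 , (λ _ → S) , (λ _ → 1ℚ) , (λ _ → ℚₚ.nonNegative⁻¹ 1ℚ) , refl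
    , λ e → ≡.sym (trans (ℚₚ.+-identityʳ (1ℚ * cutVec S e)) (ℚₚ.*-identityˡ (cutVec S e)))

  module _ {f : Vect N → ℚ} (hf : IsLinear f) {b} (valid : ∀ S → f (cutVec S) ≤ℚ b) where

    private
      -- As the weights add up to 1, the slack of a convex combination is the same combination of
      -- the slacks.
      slack-sum : ∀ {m} (S : Fin m → Subset N) (λs : Fin m → ℚ) {x : Vect N} → sumFin m λs ≡ 1ℚ →
        (∀ e → x e ≡ sumFin m (λ i → λs i * cutVec (S i) e)) →
        sumFin m (λ i → λs i * (b - f (cutVec (S i)))) ≡ b - f x
      slack-sum {m} S λs {x} Σλ≡1 x≡ = begin
        sumFin m (λ i → λs i * (b - F i))
          ≡⟨ sum-cong m (λ i → expand (λs i) (F i) b) ⟩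
        sumFin m (λ i → b * λs i + - 1ℚ * (λs i * F i))
          ≡⟨ sum-+ m (λ i → b * λs i) (λ i → - 1ℚ * (λs i * F i)) ⟩
        sumFin m (λ i → b * λs i) + sumFin m (λ i → - 1ℚ * (λs i * F i))
          ≡⟨ cong₂ _+_ (sum-* m b λs) (sum-* m (- 1ℚ) (λ i → λs i * F i)) ⟩
        b * sumFin m λs + - 1ℚ * sumFin m (λ i → λs i * F i)
          ≡⟨ cong₂ (λ s t → b * s + - 1ℚ * t) Σλ≡1 (≡.sym (hf m λs (λ i → cutVec (S i)) x x≡)) ⟩
        b * 1ℚ + - 1ℚ * f x
          ≡⟨ simplify b (f x) ⟩
        b - f x ∎
        where
        open ≡-Reasoning
        F = λ i → f (cutVec (S i))
        expand : ∀ l t b → l * (b - t) ≡ b * l + - 1ℚ * (l * t)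
        expand = solve-∀ ℚ-ring
        simplify : ∀ b t → b * 1ℚ + - 1ℚ * t ≡ b - t
        simplify = solve-∀ ℚ-ring

    cut-valid : ∀ x → InCut N x → f x ≤ℚ b
    cut-valid x (m , S , λs , λ≥0 , Σλ≡1 , x≡) =
      subst₂ _≤ℚ_ (ℚₚ.+-identityʳ (f x)) (recover (f x) b) (ℚₚ.+-monoʳ-≤ (f x) slack≥0)
      where
      recover : ∀ x y → x + (y - x) ≡ y
      recover = solve-∀ ℚ-ring
      slack≥0 : 0ℚ ≤ℚ b - f x
      slack≥0 = subst (0ℚ ≤ℚ_) (slack-sum S λs Σλ≡1 x≡)
        (sum-nonneg m (λ i → 0≤-* (λ≥0 i) (0≤-- (valid (S i)))))

    -- The weighted slacks are nonnegative with sum zero, so every cut in the combination has weight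
    -- zero or lies on the face itself.
    cut-face-vanish : ∀ {L : Vect N → ℚ} → IsLinear L →
      (∀ S → f (cutVec S) ≡ b → L (cutVec S) ≡ 0ℚ) →
      ∀ x → InCut N x → f x ≡ b → L x ≡ 0ℚ
    cut-face-vanish {L} hL vanish x (m , S , λs , λ≥0 , Σλ≡1 , x≡) fx≡b =
      trans (hL m λs (λ i → cutVec (S i)) x x≡) (sum-zero m term)
      where
      slack : ∀ i → λs i * (b - f (cutVec (S i))) ≡ 0ℚ
      slack = sum-nonneg-null m (λ i → 0≤-* (λ≥0 i) (0≤-- (valid (S i))))
        (trans (slack-sum S λs Σλ≡1 x≡) (trans (cong (b +_) (cong -_ fx≡b)) (ℚₚ.+-inverseʳ b)))
      recover : ∀ x y → x ≡ y - (y - x)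
      recover = solve-∀ ℚ-ring
      term : ∀ i → λs i * L (cutVec (S i)) ≡ 0ℚ
      term i with f (cutVec (S i)) ℚₚ.≟ b
      ... | yes f≡b = trans (cong (λs i *_) (vanish (S i) f≡b)) (ℚₚ.*-zeroʳ (λs i))
      ... | no  f≢b = trans (cong (_* L (cutVec (S i))) λ≡0) (ℚₚ.*-zeroˡ (L (cutVec (S i))))
        where
        λ≡0 : λs i ≡ 0ℚ
        λ≡0 = *-cancel-≡0 _ _ (λ eq → f≢b (trans (recover (f (cutVec (S i))) b)
          (trans (cong (b +_) (cong -_ eq)) (ℚₚ.+-identityʳ b)))) (slack i)

-- Booleans and counting

∧-split : ∀ {a b} → a ∧ b ≡ true → a ≡ true × b ≡ true
∧-split {true} {true} refl = refl , refl

∧-join : ∀ {a b} → a ≡ true → b ≡ true → a ∧ b ≡ true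
∧-join refl refl = refl

true≢false : ∀ {a} → a ≡ true → a ≢ false
true≢false refl ()

¬true⇒false : ∀ {a} → ¬ (a ≡ true) → a ≡ false
¬true⇒false {true}  h = ⊥-elim (h refl)
¬true⇒false {false} h = refl

bool-ext : ∀ {a b} → (a ≡ true → b ≡ true) → (b ≡ true → a ≡ true) → a ≡ b
bool-ext {true}  {b}     f g = ≡.sym (f refl)
bool-ext {false} {true}  f g = g refl
bool-ext {false} {false} f g = refl

does-true⁻¹ : ∀ {A : Set} (a? : Dec A) → does a? ≡ true → A
does-true⁻¹ (yes a) _ = a

eqᵇ⇒≡ : ∀ {m} {i j : Fin m} → eqᵇ i j ≡ true → i ≡ j
eqᵇ⇒≡ {i = i} {j} = does-true⁻¹ (i Fₚ.≟ j)

≡⇒eqᵇ : ∀ {m} {i j : Fin m} → i ≡ j → eqᵇ i j ≡ true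
≡⇒eqᵇ {i = i} {j} = dec-true (i Fₚ.≟ j)

anyFin-intro : ∀ m (f : Fin m → Bool) i → f i ≡ true → anyFin m f ≡ true
anyFin-intro (suc m) f zero    h rewrite h = refl
anyFin-intro (suc m) f (suc i) h rewrite anyFin-intro m (λ i → f (suc i)) i h = ∨-zeroʳ (f zero)

anyFin-elim : ∀ m (f : Fin m → Bool) → anyFin m f ≡ true → ∃ λ i → f i ≡ true
anyFin-elim (suc m) f h with f zero in eq
... | true  = zero , eq
... | false = let i , p = anyFin-elim m (λ i → f (suc i)) h in suc i , p

allFin-intro : ∀ m (f : Fin m → Bool) → (∀ i → f i ≡ true) → allFin m f ≡ true
allFin-intro zero    f h = refl
allFin-intro (suc m) f h = ∧-join (h zero) (allFin-intro m (λ i → f (suc i)) (λ i → h (suc i)))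

allFin-elim : ∀ m (f : Fin m → Bool) → allFin m f ≡ true → ∀ i → f i ≡ true
allFin-elim (suc m) f h zero    = proj₁ (∧-split h)
allFin-elim (suc m) f h (suc i) = allFin-elim m (λ i → f (suc i)) (proj₂ (∧-split {f zero} h)) i

count-none : ∀ m (p : Fin m → Bool) → (∀ i → p i ≡ false) → countFin m p ≡ 0
count-none zero    p h = refl
count-none (suc m) p h rewrite h zero = count-none m (λ i → p (suc i)) (λ i → h (suc i))

count-only : ∀ m (p : Fin m → Bool) x → (∀ i → i ≢ x → p i ≡ false) → countFin m p ≤ 1
count-only (suc m) p zero h
  rewrite count-none m (λ i → p (suc i)) (λ i → h (suc i) (λ ())) with p zero
... | true  = ℕₚ.≤-refl
... | false = z≤n
count-only (suc m) p (suc x) h rewrite h zero (λ ()) =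
  count-only m (λ i → p (suc i)) x (λ i i≢x → h (suc i) (λ eq → i≢x (Fₚ.suc-injective eq)))

count-some : ∀ m (p : Fin m → Bool) i → p i ≡ true → 1 ≤ countFin m p
count-some (suc m) p zero    h rewrite h = s≤s z≤n
count-some (suc m) p (suc i) h = ℕₚ.m≤n⇒m≤o+n _ (count-some m (λ i → p (suc i)) i h)

count-two : ∀ m (p : Fin m → Bool) i j → i ≢ j → p i ≡ true → p j ≡ true → 2 ≤ countFin m p
count-two (suc m) p zero    zero    i≢j hi hj = ⊥-elim (i≢j refl)
count-two (suc m) p zero    (suc j) i≢j hi hj rewrite hi = s≤s (count-some m (λ i → p (suc i)) j hj)
count-two (suc m) p (suc i) zero    i≢j hi hj rewrite hj = s≤s (count-some m (λ i → p (suc i)) i hi)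
count-two (suc m) p (suc i) (suc j) i≢j hi hj =
  ℕₚ.m≤n⇒m≤o+n _ (count-two m (λ i → p (suc i)) i j (λ eq → i≢j (cong suc eq)) hi hj)

count-another : ∀ m (p : Fin m → Bool) → 2 ≤ countFin m p → ∀ x → ∃ λ y → y ≢ x × p y ≡ true
count-another m p 2≤c x with Fₚ.any? (λ y → ¬? (y Fₚ.≟ x) ×-dec (p y Boolₚ.≟ true))
... | yes found = found
... | no none   = ⊥-elim (ℕₚ.<⇒≱ 2≤c
  (count-only m p x (λ i i≢x → ¬true⇒false (λ pi → none (i , i≢x , pi)))))

sumℕ-term : ∀ m (f : Fin m → ℕ) i → f i ≤ sumℕ m f
sumℕ-term (suc m) f zero    = ℕₚ.m≤m+n (f zero) _
sumℕ-term (suc m) f (suc i) = ℕₚ.m≤n⇒m≤o+n (f zero) (sumℕ-term m (λ i → f (suc i)) i)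

edgeCount-pos : ∀ {n} (H : Graph n) u v → adj H u v ≡ true → 1 ≤ edgeCount H
edgeCount-pos {n} H u v uv with Fₚ.<-cmp u v
... | tri< u<v _ _ = ℕₚ.≤-trans (count-some n _ v (∧-join (dec-true (u F.<? v) u<v) uv)) (sumℕ-term n _ u)
... | tri≈ _ refl _ = ⊥-elim (true≢false uv (irrfl H u))
... | tri> _ _ v<u = ℕₚ.≤-trans
  (count-some n _ u (∧-join (dec-true (v F.<? u) v<u) (trans (Graph.sym H v u) uv))) (sumℕ-term n _ v)

-- Sums of indicators

ind : Bool → ℚ
ind b = if b then 1ℚ else 0ℚ

ind-nonneg : ∀ b → 0ℚ ≤ℚ ind b
ind-nonneg true  = ℚₚ.nonNegative⁻¹ 1ℚ
ind-nonneg false = ℚₚ.≤-refl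

ind-mono : ∀ {a b} → (a ≡ true → b ≡ true) → ind a ≤ℚ ind b
ind-mono {false} {b} h = ind-nonneg b
ind-mono {true}  {b} h rewrite h refl = ℚₚ.≤-refl

ind-sum-≤ : ∀ m (P : Fin m → Bool) c → (∀ i → P i ≡ true → c ≡ true) →
  (∀ i j → P i ≡ true → P j ≡ true → i ≡ j) → sumFin m (λ i → ind (P i)) ≤ℚ ind c
ind-sum-≤ m P c sub unique with Fₚ.any? (λ i → P i Boolₚ.≟ true)
... | no none = subst (_≤ℚ ind c)
  (≡.sym (sum-zero m (λ i → cong ind (¬true⇒false (λ Pi → none (i , Pi)))))) (ind-nonneg c)
... | yes (k , Pk) rewrite sub k Pk = ℚₚ.≤-reflexive (trans
  (sum-single m _ k (λ i i≢k → cong ind (¬true⇒false (λ Pi → i≢k (unique i k Pi Pk)))))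
  (cong ind Pk))

ind-sum-≥1 : ∀ m (P : Fin m → Bool) i → P i ≡ true → 1ℚ ≤ℚ sumFin m (λ i → ind (P i))
ind-sum-≥1 (suc m) P i Pi = begin
  1ℚ                                                     ≡⟨ ℚₚ.+-identityʳ 1ℚ ⟨
  1ℚ + 0ℚ                                                ≤⟨ ℚₚ.+-mono-≤ (ℚₚ.≤-reflexive (cong ind (≡.sym Pi)))
                                                            (sum-nonneg m (λ j → ind-nonneg (P (punchIn i j)))) ⟩
  ind (P i) + sumFin m (λ j → ind (P (punchIn i j)))     ≡⟨ sum-remove i (λ i → ind (P i)) ⟨
  sumFin (suc m) (λ i → ind (P i))                       ∎
  where open ℚₚ.≤-Reasoning

ind-sum-≥2 : ∀ m (P : Fin m → Bool) i j → i ≢ j → P i ≡ true → P j ≡ true →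
  two ≤ℚ sumFin m (λ i → ind (P i))
ind-sum-≥2 (suc m) P i j i≢j Pi Pj = begin
  1ℚ + 1ℚ
    ≤⟨ ℚₚ.+-mono-≤ (ℚₚ.≤-reflexive (cong ind (≡.sym Pi)))
                   (ind-sum-≥1 m (λ j → P (punchIn i j)) (punchOut i≢j)
                     (trans (cong P (Fₚ.punchIn-punchOut i≢j)) Pj)) ⟩
  ind (P i) + sumFin m (λ j → ind (P (punchIn i j)))
    ≡⟨ sum-remove i (λ i → ind (P i)) ⟨
  sumFin (suc m) (λ i → ind (P i)) ∎
  where open ℚₚ.≤-Reasoning

sum² : ∀ n → (Fin n → Fin n → ℚ) → ℚ
sum² n f = sumFin n λ a → sumFin n λ b → f a b

sum²-mono : ∀ n {f g : Fin n → Fin n → ℚ} → (∀ a b → f a b ≤ℚ g a b) → sum² n f ≤ℚ sum² n g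
sum²-mono n h = sum-mono n (λ a → sum-mono n (h a))

sum²-single : ∀ n (f : Fin n → Fin n → ℚ) x y → (∀ a b → ¬ (a ≡ x × b ≡ y) → f a b ≡ 0ℚ) →
  sum² n f ≡ f x y
sum²-single n f x y h =
  trans (sum-single n _ x (λ a a≢x → sum-zero n (λ b → h a b (λ p → a≢x (proj₁ p)))))
        (sum-single n (f x) y (λ b b≢y → h x b (λ p → b≢y (proj₂ p))))

sum²-+ : ∀ n (f g : Fin n → Fin n → ℚ) →
  sum² n (λ a b → f a b + g a b) ≡ sum² n f + sum² n g
sum²-+ n f g = trans (sum-cong n (λ a → sum-+ n (f a) (g a))) (sum-+ n _ _)

atPair : ∀ {n} → Fin n → Fin n → Fin n → Fin n → Bool
atPair x y a b = eqᵇ a x ∧ eqᵇ b y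

atPair-elim : ∀ {n} (x y a b : Fin n) → atPair x y a b ≡ true → a ≡ x × b ≡ y
atPair-elim x y a b h = let p , q = ∧-split {eqᵇ a x} h in eqᵇ⇒≡ p , eqᵇ⇒≡ q

sum²-atPair : ∀ n c (x y : Fin n) → sum² n (λ a b → ind (c ∧ atPair x y a b)) ≡ ind c
sum²-atPair n false x y = sum-zero n (λ a → sum-zero n (λ b → refl))
sum²-atPair n true  x y = trans
  (sum²-single n _ x y (λ a b ne → cong ind (¬true⇒false (λ h → ne (atPair-elim x y a b h)))))
  (cong ind (∧-join (≡⇒eqᵇ {i = x} refl) (≡⇒eqᵇ {i = y} refl)))

-- Double counting: one witnessing pair is chosen for every `v`, and by injectivity each pair is
-- chosen at most once.
count-by-witness : ∀ n (p : Fin n → Bool) (q : Fin n → Fin n → Bool) (W : Fin n → Fin n → Fin n → Set) →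
  (∀ v → p v ≡ true → ∃ λ a → ∃ λ b → W v a b) →
  (∀ v a b → W v a b → q a b ≡ true) →
  (∀ v v′ a b → p v ≡ true → p v′ ≡ true → W v a b → W v′ a b → v ≡ v′) →
  sumFin n (λ v → ind (p v)) ≤ℚ sum² n (λ a b → ind (q a b))
count-by-witness n p q W wit sub inj = begin
  sumFin n (λ v → ind (p v))
    ≡⟨ sum-cong n (λ v → ≡.sym (unfold v)) ⟩
  sumFin n (λ v → sum² n (λ a b → ind (r v a b)))
    ≡⟨ sum-swap n n _ ⟩
  sumFin n (λ a → sumFin n (λ v → sumFin n (λ b → ind (r v a b))))
    ≡⟨ sum-cong n (λ a → sum-swap n n _) ⟩
  sum² n (λ a b → sumFin n (λ v → ind (r v a b)))
    ≤⟨ sum²-mono n (λ a b → ind-sum-≤ n (λ v → r v a b) (q a b) (λ v → r⇒q v a b) (r-unique a b)) ⟩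
  sum² n (λ a b → ind (q a b)) ∎
  where
  open ℚₚ.≤-Reasoning
  choose : ∀ v → Σ (Fin n × Fin n) λ ab → p v ≡ true → W v (proj₁ ab) (proj₂ ab)
  choose v with p v Boolₚ.≟ true
  ... | yes pv = let a , b , w = wit v pv in (a , b) , λ _ → w
  -- The default pair is never counted, since `r` requires `p v`.
  ... | no ¬pv = (v , v) , λ pv → ⊥-elim (¬pv pv)
  x y : Fin n → Fin n
  x v = proj₁ (proj₁ (choose v))
  y v = proj₂ (proj₁ (choose v))
  r : Fin n → Fin n → Fin n → Bool
  r v a b = p v ∧ atPair (x v) (y v) a b
  r-elim : ∀ v a b → r v a b ≡ true → p v ≡ true × W v a b
  r-elim v a b h with ∧-split {p v} h
  ... | pv , at with atPair-elim (x v) (y v) a b at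
  ... | refl , refl = pv , proj₂ (choose v) pv
  r⇒q : ∀ v a b → r v a b ≡ true → q a b ≡ true
  r⇒q v a b h = sub v a b (proj₂ (r-elim v a b h))
  r-unique : ∀ a b v v′ → r v a b ≡ true → r v′ a b ≡ true → v ≡ v′
  r-unique a b v v′ h h′ =
    let pv , w = r-elim v a b h ; pv′ , w′ = r-elim v′ a b h′ in inj v v′ a b pv pv′ w w′
  unfold : ∀ v → sum² n (λ a b → ind (r v a b)) ≡ ind (p v)
  unfold v = sum²-atPair n (p v) (x v) (y v)

-- Cuts with node n+1 outside, and their polar form

avoid : ∀ {n} → (Fin n → Bool) → Subset (suc n)
avoid {zero}  R i       = false
avoid {suc n} R zero    = R zero
avoid {suc n} R (suc i) = avoid (λ j → R (suc j)) i

avoid-inject₁ : ∀ {n} (R : Fin n → Bool) u → avoid R (inject₁ u) ≡ R u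
avoid-inject₁ R zero    = refl
avoid-inject₁ R (suc u) = avoid-inject₁ (λ j → R (suc j)) u

avoid-top : ∀ {n} (R : Fin n → Bool) → avoid R (fromℕ n) ≡ false
avoid-top {zero}  R = refl
avoid-top {suc n} R = avoid-top (λ j → R (suc j))

avoid-xor : ∀ {n} (R : Fin n → Bool) u → R u ≡ xorᵇ (avoid R (inject₁ u)) (avoid R (fromℕ n))
avoid-xor R u rewrite avoid-inject₁ R u | avoid-top R = xor-false (R u)
  where
  xor-false : ∀ a → a ≡ xorᵇ a false
  xor-false true  = refl
  xor-false false = refl

avoid-cong : ∀ {n} {A B : Fin n → Bool} → (∀ u → A u ≡ B u) → ∀ i → avoid A i ≡ avoid B i
avoid-cong {zero}  h i       = refl
avoid-cong {suc n} h zero    = h zero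
avoid-cong {suc n} h (suc i) = avoid-cong (λ j → h (suc j)) i

infixr 6 _∪_

-- Opacity lets sets be inferred from membership in them.
opaque
  _∪_ : ∀ {A : Set} → (A → Bool) → (A → Bool) → A → Bool
  (A ∪ B) v = A v ∨ B v

  ∪-comm : ∀ {X : Set} (A B : X → Bool) v → (A ∪ B) v ≡ (B ∪ A) v
  ∪-comm A B v = ∨-comm (A v) (B v)

  ∪-elim : ∀ {X : Set} (A B : X → Bool) {v} → (A ∪ B) v ≡ true → A v ≡ true ⊎ B v ≡ true
  ∪-elim A B {v} h with A v
  ... | true  = inj₁ refl
  ... | false = inj₂ h

  ∪-introˡ : ∀ {X : Set} (A B : X → Bool) {v} → A v ≡ true → (A ∪ B) v ≡ true
  ∪-introˡ A B h rewrite h = refl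

  ∪-introʳ : ∀ {X : Set} (A B : X → Bool) {v} → B v ≡ true → (A ∪ B) v ≡ true
  ∪-introʳ A B {v} h rewrite h = ∨-zeroʳ (A v)

  avoid-∪ : ∀ {n} (A B : Fin n → Bool) i → avoid (A ∪ B) i ≡ (avoid A ∪ avoid B) i
  avoid-∪ {zero}  A B i       = refl
  avoid-∪ {suc n} A B zero    = refl
  avoid-∪ {suc n} A B (suc i) = avoid-∪ (λ j → A (suc j)) (λ j → B (suc j)) i

Disjoint : ∀ {A : Set} → (A → Bool) → (A → Bool) → Set
Disjoint A B = ∀ v → A v ≡ true → ¬ (B v ≡ true)

∪-disjoint : ∀ {X : Set} {A B C : X → Bool} → Disjoint A C → Disjoint B C → Disjoint (A ∪ B) C
∪-disjoint {A = A} {B} dA dB v h with ∪-elim A B h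
... | inj₁ Av = dA v Av
... | inj₂ Bv = dB v Bv

avoid-disjoint : ∀ {n} {A B : Fin n → Bool} → Disjoint A B → Disjoint (avoid A) (avoid B)
avoid-disjoint {zero}  d i       = λ ()
avoid-disjoint {suc n} d zero    = d zero
avoid-disjoint {suc n} d (suc i) = avoid-disjoint (λ j → d (suc j)) i

-- The polarization of the quadratic map S ↦ cutVec S.
crossVec : ∀ {N} → Subset N → Subset N → Vect N
crossVec A B (i , j , _) = ind (A i ∧ B j) + ind (A j ∧ B i)

¬both : ∀ {a b} → (a ≡ true → ¬ (b ≡ true)) → a ≡ false ⊎ b ≡ false
¬both {false}         h = inj₁ refl
¬both {true}  {false} h = inj₂ refl
¬both {true}  {true}  h = ⊥-elim (h refl refl)

opaque
  unfolding _∪_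

  -- An edge between `A` and `B` is cut by each of the two sets but not by their union, hence the
  -- correction by `two`.
  cutVec-∪ : ∀ {N} {A B : Subset N} → Disjoint A B → ∀ e →
    cutVec (A ∪ B) e ≡ 1ℚ * cutVec A e + 1ℚ * cutVec B e + - two * crossVec A B e
  cutVec-∪ {A = A} {B} d (i , j , _) = bool-cases (A i) (B i) (A j) (B j) (¬both (d i)) (¬both (d j))
    where
    bool-cases : ∀ a b a′ b′ → a ≡ false ⊎ b ≡ false → a′ ≡ false ⊎ b′ ≡ false →
      ind (xorᵇ (a ∨ b) (a′ ∨ b′))
        ≡ 1ℚ * ind (xorᵇ a a′) + 1ℚ * ind (xorᵇ b b′) + - two * (ind (a ∧ b′) + ind (a′ ∧ b))
    bool-cases _ true  _ true  (inj₁ refl) (inj₁ refl) = refl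
    bool-cases _ true  _ false (inj₁ refl) (inj₁ refl) = refl
    bool-cases _ false _ true  (inj₁ refl) (inj₁ refl) = refl
    bool-cases _ false _ false (inj₁ refl) (inj₁ refl) = refl
    bool-cases _ true  true  _ (inj₁ refl) (inj₂ refl) = refl
    bool-cases _ true  false _ (inj₁ refl) (inj₂ refl) = refl
    bool-cases _ false true  _ (inj₁ refl) (inj₂ refl) = refl
    bool-cases _ false false _ (inj₁ refl) (inj₂ refl) = refl
    bool-cases true  _ _ true  (inj₂ refl) (inj₁ refl) = refl
    bool-cases true  _ _ false (inj₂ refl) (inj₁ refl) = refl
    bool-cases false _ _ true  (inj₂ refl) (inj₁ refl) = refl
    bool-cases false _ _ false (inj₂ refl) (inj₁ refl) = refl
    bool-cases true  _ true  _ (inj₂ refl) (inj₂ refl) = refl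
    bool-cases true  _ false _ (inj₂ refl) (inj₂ refl) = refl
    bool-cases false _ true  _ (inj₂ refl) (inj₂ refl) = refl
    bool-cases false _ false _ (inj₂ refl) (inj₂ refl) = refl

  -- The term with coefficient 0 brings the sum into the three-term shape of `linear-combination`.
  crossVec-∪ : ∀ {N} {A B C : Subset N} → Disjoint A B → ∀ e →
    crossVec (A ∪ B) C e ≡ 1ℚ * crossVec A C e + 1ℚ * crossVec B C e + 0ℚ * crossVec A B e
  crossVec-∪ {A = A} {B} {C} d (i , j , _) = trans
    (cong₂ _+_ (distrib (C j) (¬both (d i))) (distrib (C i) (¬both (d j))))
    (regroup (ind (A i ∧ C j)) (ind (B i ∧ C j)) (ind (A j ∧ C i)) (ind (B j ∧ C i))
             (ind (A i ∧ B j) + ind (A j ∧ B i)))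
    where
    distrib : ∀ {a b} c → a ≡ false ⊎ b ≡ false → ind ((a ∨ b) ∧ c) ≡ ind (a ∧ c) + ind (b ∧ c)
    distrib {b = b} c (inj₁ refl) = ≡.sym (ℚₚ.+-identityˡ (ind (b ∧ c)))
    distrib {true}  c (inj₂ refl) = ≡.sym (ℚₚ.+-identityʳ (ind c))
    distrib {false} c (inj₂ refl) = refl
    regroup : ∀ p q r s t → (p + q) + (r + s) ≡ 1ℚ * (p + r) + 1ℚ * (q + s) + 0ℚ * t
    regroup = solve-∀ ℚ-ring

module CutForm {n : ℕ} {L : Vect (suc n) → ℚ} (hL : IsLinear L) where

  φ : (Fin n → Bool) → ℚ
  φ A = L (cutVec (avoid A))

  β : (Fin n → Bool) → (Fin n → Bool) → ℚ
  β A B = L (crossVec (avoid A) (avoid B))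

  φ-cong : ∀ {A B} → (∀ u → A u ≡ B u) → φ A ≡ φ B
  φ-cong h = linear-cong hL λ where
    (i , j , _) → cong₂ (λ a b → ind (xorᵇ a b)) (avoid-cong h i) (avoid-cong h j)

  β-cong : ∀ {A A′ B} → (∀ u → A u ≡ A′ u) → β A B ≡ β A′ B
  β-cong {B = B} h = linear-cong hL λ where
    (i , j , _) → cong₂ (λ a b → ind (a ∧ avoid B j) + ind (b ∧ avoid B i)) (avoid-cong h i) (avoid-cong h j)

  β-sym : ∀ A B → β A B ≡ β B A
  β-sym A B = linear-cong hL λ where
    (i , j , _) → trans (ℚₚ.+-comm (ind (avoid A i ∧ avoid B j)) (ind (avoid A j ∧ avoid B i)))
      (cong₂ (λ a b → ind a + ind b) (∧-comm (avoid A j) (avoid B i)) (∧-comm (avoid A i) (avoid B j)))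

  φ-∪ : ∀ {A B} → Disjoint A B → φ (A ∪ B) ≡ φ A + φ B - two * β A B
  φ-∪ {A} {B} d = trans
    (linear-combination hL 1ℚ 1ℚ (- two) (cutVec (avoid A)) (cutVec (avoid B)) (crossVec (avoid A) (avoid B)) _
      (λ where e@(i , j , _) → trans
                 (cong₂ (λ a b → ind (xorᵇ a b)) (avoid-∪ A B i) (avoid-∪ A B j))
                 (cutVec-∪ (avoid-disjoint d) e)))
    (simplify (φ A) (φ B) two (β A B))
    where
    simplify : ∀ x y t z → 1ℚ * x + 1ℚ * y + - t * z ≡ x + y - t * z
    simplify = solve-∀ ℚ-ring

  β-∪ : ∀ {A B} C → Disjoint A B → β (A ∪ B) C ≡ β A C + β B C
  β-∪ {A} {B} C d = trans
    (linear-combination hL 1ℚ 1ℚ 0ℚ (crossVec (avoid A) (avoid C)) (crossVec (avoid B) (avoid C))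
      (crossVec (avoid A) (avoid B)) _
      (λ where e@(i , j , _) → trans
                 (cong₂ (λ a b → ind (a ∧ avoid C j) + ind (b ∧ avoid C i)) (avoid-∪ A B i) (avoid-∪ A B j))
                 (crossVec-∪ {C = avoid C} (avoid-disjoint d) e)))
    (simplify (β A C) (β B C) (β A B))
    where
    simplify : ∀ x y z → 1ℚ * x + 1ℚ * y + 0ℚ * z ≡ x + y
    simplify = solve-∀ ℚ-ring

  -- For use with roots `A` and `A ∪ B`: it trades the value of φ at the added part for a value of
  -- β, which is additive in `A`.
  φ-∪-null : ∀ {A B} → Disjoint A B → φ (A ∪ B) ≡ 0ℚ → φ A ≡ 0ℚ → φ B ≡ two * β A B
  φ-∪-null {A} {B} d hAB hA = trans (expand (φ B) (two * β A B))
    (trans (cong (λ z → (z + φ B - two * β A B) + two * β A B) (≡.sym hA))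
    (trans (cong (_+ two * β A B) (trans (≡.sym (φ-∪ d)) hAB)) (ℚₚ.+-identityˡ (two * β A B))))
    where
    expand : ∀ x y → x ≡ (0ℚ + x - y) + y
    expand = solve-∀ ℚ-ring

  half : ∀ x → two * x ≡ 0ℚ → x ≡ 0ℚ
  half x h = *-cancel-≡0 x two (λ ()) (trans (ℚₚ.*-comm x two) h)

  β-null : ∀ {A B} → Disjoint A B → φ (A ∪ B) ≡ 0ℚ → φ A ≡ 0ℚ → φ B ≡ 0ℚ → β A B ≡ 0ℚ
  β-null d hAB hA hB = half _ (trans (≡.sym (φ-∪-null d hAB hA)) hB)

  β-complement : ∀ {A B} C → Disjoint A B → β (A ∪ B) C ≡ 0ℚ → β A C ≡ 0ℚ → β B C ≡ 0ℚ
  β-complement {A} {B} C d hAB hA =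
    trans (≡.sym (ℚₚ.+-identityˡ (β B C))) (trans (cong (_+ β B C) (≡.sym hA)) (trans (≡.sym (β-∪ C d)) hAB))

-- Coefficients of a form, read off at single nodes

opaque
  node : ∀ {n} → Fin n → Fin n → Bool
  node u v = eqᵇ v u

  node-elim : ∀ {n} {u v : Fin n} → node u v ≡ true → v ≡ u
  node-elim = eqᵇ⇒≡

  node-intro : ∀ {n} {u v : Fin n} → v ≡ u → node u v ≡ true
  node-intro = ≡⇒eqᵇ

node-self : ∀ {n} (u : Fin n) → node u u ≡ true
node-self u = node-intro refl

node-disjoint : ∀ {n} (A : Fin n → Bool) {u} → ¬ (A u ≡ true) → Disjoint A (node u)
node-disjoint A ¬Au v Av nv = ¬Au (subst (λ w → A w ≡ true) (node-elim nv) Av)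

edge-≡ : ∀ {N} {i j : Fin N} (p q : i F.< j) → _≡_ {A = Edge N} (i , j , p) (i , j , q)
edge-≡ p q = cong (λ r → _ , _ , r) (ℕₚ.<-irrelevant p q)

module _ {n : ℕ} (a : Fin (edgeSize (suc n)) → ℚ) where
  open CutForm (form-linear {suc n} a)

  ind-false : ∀ {b} → ¬ (b ≡ true) → ind b ≡ 0ℚ
  ind-false h = cong ind (¬true⇒false h)

  node-avoid : ∀ (u : Fin n) i → avoid (node u) i ≡ true → i ≡ inject₁ u
  node-avoid u i h with Top.view i
  ... | Top.‵fromℕ     = ⊥-elim (true≢false h (avoid-top (node u)))
  ... | Top.‵inject₁ j = cong inject₁ (node-elim (trans (≡.sym (avoid-inject₁ (node u) j)) h))

  node-avoid-self : ∀ (u : Fin n) → avoid (node u) (inject₁ u) ≡ true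
  node-avoid-self u = trans (avoid-inject₁ (node u) u) (node-self u)

  unit-coefficient : ∀ {x : Vect (suc n)} e → form a x ≡ 0ℚ → x e ≡ 1ℚ →
    (∀ e′ → e′ ≢ e → a (edgeIndex e′) * x e′ ≡ 0ℚ) → a (edgeIndex e) ≡ 0ℚ
  unit-coefficient {x} e h xe off = begin
    a (edgeIndex e)            ≡⟨ ℚₚ.*-identityʳ (a (edgeIndex e)) ⟨
    a (edgeIndex e) * 1ℚ       ≡⟨ cong (a (edgeIndex e) *_) xe ⟨
    a (edgeIndex e) * x e      ≡⟨ form-single {suc n} a x e off ⟨
    form a x                   ≡⟨ h ⟩
    0ℚ                         ∎
    where open ≡-Reasoning

  -- The cross vector of two single nodes is the unit vector of the edge between them, so β takes
  -- the coefficient of that edge as its value.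
  inner-null : (∀ u v → u ≢ v → β (node u) (node v) ≡ 0ℚ) →
    ∀ u v (p : inject₁ u F.< inject₁ v) → a (edgeIndex (inject₁ u , inject₁ v , p)) ≡ 0ℚ
  inner-null hβ u v p = unit-coefficient _ (hβ u v u≢v) value off
    where
    u≢v : u ≢ v
    u≢v refl = ℕₚ.<-irrefl refl p
    x = crossVec (avoid (node u)) (avoid (node v))
    swapped : ¬ (avoid (node u) (inject₁ v) ∧ avoid (node v) (inject₁ u) ≡ true)
    swapped h = u≢v (≡.sym (Fₚ.inject₁-injective (node-avoid u (inject₁ v) (proj₁ (∧-split h)))))
    value : x (inject₁ u , inject₁ v , p) ≡ 1ℚ
    value rewrite node-avoid-self u | node-avoid-self v | ind-false swapped = refl
    off : ∀ e′ → e′ ≢ (inject₁ u , inject₁ v , p) → a (edgeIndex e′) * x e′ ≡ 0ℚ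
    off e′@(i , j , q) ne = trans (cong (a (edgeIndex e′) *_)
        (cong₂ _+_ (ind-false direct) (ind-false reverse))) (ℚₚ.*-zeroʳ (a (edgeIndex e′)))
      where
      direct : ¬ (avoid (node u) i ∧ avoid (node v) j ≡ true)
      direct h with ∧-split {avoid (node u) i} h
      ... | hi , hj with node-avoid u i hi | node-avoid v j hj
      ... | refl | refl = ne (edge-≡ q p)
      reverse : ¬ (avoid (node u) j ∧ avoid (node v) i ≡ true)
      reverse h with ∧-split {avoid (node u) j} h
      ... | hj , hi with node-avoid u j hj | node-avoid v i hi
      ... | refl | refl = ℕₚ.<-asym p q

  -- Once the coefficients inside V are zero, φ at the single node `u` reduces to the coefficient of
  -- the edge from `u` to n+1.
  form-null : (∀ u → φ (node u) ≡ 0ℚ) → (∀ u v → u ≢ v → β (node u) (node v) ≡ 0ℚ) → ∀ k → a k ≡ 0ℚ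
  form-null hφ hβ k = trans (cong a (≡.sym (edgeIndex-at (suc n) k))) (coefficient (edgeAt (suc n) k))
    where
    coefficient : ∀ e → a (edgeIndex e) ≡ 0ℚ
    coefficient (i , j , p) with Top.view i | Top.view j
    ... | Top.‵inject₁ u | Top.‵inject₁ v = inner-null hβ u v p
    ... | Top.‵fromℕ     | _              = ⊥-elim (ℕₚ.<⇒≱ p (Fₚ.≤fromℕ j))
    ... | Top.‵inject₁ u | Top.‵fromℕ     = unit-coefficient _ (hφ u) value off
      where
      x = cutVec (avoid (node u))
      value : x (inject₁ u , fromℕ n , p) ≡ 1ℚ
      value rewrite node-avoid-self u | avoid-top (node u) = refl
      off : ∀ e′ → e′ ≢ (inject₁ u , fromℕ n , p) → a (edgeIndex e′) * x e′ ≡ 0ℚ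
      off (i , j , q) ne with Top.view i | Top.view j
      ... | Top.‵fromℕ      | _               = ⊥-elim (ℕₚ.<⇒≱ q (Fₚ.≤fromℕ j))
      ... | Top.‵inject₁ u′ | Top.‵inject₁ v′ =
        trans (cong (_* x (inject₁ u′ , inject₁ v′ , q)) (inner-null hβ u′ v′ q))
              (ℚₚ.*-zeroˡ (x (inject₁ u′ , inject₁ v′ , q)))
      ... | Top.‵inject₁ u′ | Top.‵fromℕ      = trans (cong (a (edgeIndex (inject₁ u′ , fromℕ n , q)) *_) x≡0)
                                                      (ℚₚ.*-zeroʳ (a (edgeIndex (inject₁ u′ , fromℕ n , q))))
        where
        outside : ¬ (avoid (node u) (inject₁ u′) ≡ true)
        outside h with node-avoid u (inject₁ u′) h
        ... | eq with Fₚ.inject₁-injective {i = u′} eq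
        ... | refl = ne (edge-≡ q p)
        x≡0 : x (inject₁ u′ , fromℕ n , q) ≡ 0ℚ
        x≡0 rewrite ¬true⇒false outside | avoid-top (node u) = refl

-- Components and roots

ind-split : ∀ b c → ind b ≤ℚ ind (b ∧ not c) + ind c
ind-split true  true  = ℚₚ.≤-refl
ind-split true  false = ℚₚ.≤-refl
ind-split false true  = ℚₚ.nonNegative⁻¹ 1ℚ
ind-split false false = ℚₚ.≤-refl

ltᵇ⇒< : ∀ {n} (a b : Fin n) → ltᵇ a b ≡ true → a F.< b
ltᵇ⇒< a b = does-true⁻¹ (a F.<? b)

1+x≰x : ∀ x → ¬ (1ℚ + x ≤ℚ x)
1+x≰x x h = from-no (1ℚ ℚₚ.≤? 0ℚ)
  (subst₂ _≤ℚ_ (cancel x) (ℚₚ.+-inverseʳ x) (ℚₚ.+-monoˡ-≤ (- x) h))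
  where
  cancel : ∀ x → 1ℚ + x - x ≡ 1ℚ
  cancel = solve-∀ ℚ-ring

-- mate u is the other node of the component of u, and u itself if that component is a single node.
module Components {n : ℕ} (G : Graph n) (mate : Fin n → Fin n) (mate-mate : ∀ u → mate (mate u) ≡ u) where

  Same : Fin n → Fin n → Set
  Same u v = v ≡ u ⊎ v ≡ mate u

  same? : ∀ u v → Dec (Same u v)
  same? u v = (v Fₚ.≟ u) ⊎-dec (v Fₚ.≟ mate u)

  same-refl : ∀ {u} → Same u u
  same-refl = inj₁ refl

  same-mate : ∀ {u} → Same u (mate u)
  same-mate = inj₂ refl

  same-sym : ∀ {u v} → Same u v → Same v u
  same-sym (inj₁ refl) = inj₁ refl
  same-sym (inj₂ refl) = inj₂ (≡.sym (mate-mate _))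

  same-trans : ∀ {u v w} → Same u v → Same v w → Same u w
  same-trans (inj₁ refl) s           = s
  same-trans (inj₂ refl) (inj₁ refl) = inj₂ refl
  same-trans (inj₂ refl) (inj₂ refl) = inj₁ (mate-mate _)

  full : (Fin n → Bool) → Fin n → Bool
  full R a = R a ∧ R (mate a)

  -- A full component is represented by its smaller node, so that a sum over nodes counts
  -- components. The negated strict comparison also admits single nodes, where `mate a` is `a`.
  rep : (Fin n → Bool) → Fin n → Bool
  rep R a = full R a ∧ not (ltᵇ (mate a) a)

  edgeIn : (Fin n → Bool) → Fin n → Fin n → Bool
  edgeIn R a b = (ltᵇ a b ∧ adj G a b) ∧ (R a ∧ R b)

  fullCount edgesIn : (Fin n → Bool) → ℚ
  fullCount R = sumFin n (λ v → ind (rep R v))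
  edgesIn R = sum² n (λ a b → ind (edgeIn R a b))

  -- For a cut R avoiding node n+1, I(G,H) reads fullCount R ≤ 1 + edgesIn R.
  Root : (Fin n → Bool) → Set
  Root R = fullCount R ≡ 1ℚ + edgesIn R

  full-same : ∀ R {u v} → full R u ≡ true → Same u v → full R v ≡ true
  full-same R h (inj₁ refl) = h
  full-same R {u} h (inj₂ refl) =
    let Ru , Rmu = ∧-split {R u} h in ∧-join Rmu (trans (cong R (mate-mate u)) Ru)

  full⇒∈ : ∀ R {u v} → full R u ≡ true → Same u v → R v ≡ true
  full⇒∈ R h s = proj₁ (∧-split (full-same R h s))

  adj-sym : ∀ {a b} → adj G a b ≡ true → adj G b a ≡ true
  adj-sym {a} {b} h = trans (Graph.sym G b a) h

  orient : ∀ {a b} → adj G a b ≡ true → ltᵇ a b ≡ true ⊎ ltᵇ b a ≡ true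
  orient {a} {b} h with Fₚ.<-cmp a b
  ... | tri< a<b _ _  = inj₁ (dec-true (a F.<? b) a<b)
  ... | tri≈ _ refl _ = ⊥-elim (true≢false h (irrfl G a))
  ... | tri> _ _ b<a  = inj₂ (dec-true (b F.<? a) b<a)

  not-lt : ∀ (a b : Fin n) → not (ltᵇ a b) ≡ true → ¬ a F.< b
  not-lt a b h a<b with dec-true (a F.<? b) a<b
  ... | eq rewrite eq with h
  ... | ()

  rep-unique : ∀ R {u v} → rep R u ≡ true → rep R v ≡ true → Same u v → u ≡ v
  rep-unique R hu hv (inj₁ refl) = refl
  rep-unique R {u} hu hv (inj₂ refl) with Fₚ.<-cmp u (mate u)
  ... | tri≈ _ eq _   = eq
  ... | tri< u<mu _ _ = ⊥-elim (not-lt _ _ (proj₂ (∧-split {full R (mate u)} hv))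
                          (subst (λ (w : Fin n) → w F.< mate u) (≡.sym (mate-mate u)) u<mu))
  ... | tri> _ _ mu<u = ⊥-elim (not-lt _ _ (proj₂ (∧-split {full R u} hu)) mu<u)

  rep-exists : ∀ R {u} → full R u ≡ true → ∃ λ v → Same u v × rep R v ≡ true
  rep-exists R {u} h with mate u F.<? u
  ... | no mu≮u = u , same-refl , ∧-join h (cong not (dec-false (mate u F.<? u) mu≮u))
  ... | yes mu<u = mate u , same-mate , ∧-join (full-same R h same-mate)
    (cong not (dec-false (mate (mate u) F.<? mate u)
      (λ h′ → ℕₚ.<-asym mu<u (subst (λ (w : Fin n) → w F.< mate u) (mate-mate u) h′))))

  edgesIn-nonneg : ∀ R → 0ℚ ≤ℚ edgesIn R
  edgesIn-nonneg R = sum-nonneg n (λ a → sum-nonneg n (λ b → ind-nonneg (edgeIn R a b)))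

  edgeIn-mono : ∀ R a b → edgeIn (full R) a b ≡ true → edgeIn R a b ≡ true
  edgeIn-mono R a b h with ∧-split {ltᵇ a b ∧ adj G a b} h
  ... | e , f with ∧-split {full R a} f
  ... | fa , fb = ∧-join e (∧-join (proj₁ (∧-split {R a} fa)) (proj₁ (∧-split {R b} fb)))

  edgesIn-mono : ∀ R → edgesIn (full R) ≤ℚ edgesIn R
  edgesIn-mono R = sum²-mono n (λ a b → ind-mono (edgeIn-mono R a b))

  edgesIn-extra : ∀ R {x y} → edgeIn R x y ≡ true → ¬ (edgeIn (full R) x y ≡ true) →
    1ℚ + edgesIn (full R) ≤ℚ edgesIn R
  edgesIn-extra R {x} {y} Rxy ¬fxy = begin
    1ℚ + edgesIn (full R)
      ≡⟨ cong (_+ edgesIn (full R)) (sum²-atPair n true x y) ⟨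
    sum² n (λ a b → ind (atPair x y a b)) + edgesIn (full R)
      ≡⟨ sum²-+ n (λ a b → ind (atPair x y a b)) (λ a b → ind (edgeIn (full R) a b)) ⟨
    sum² n (λ a b → ind (atPair x y a b) + ind (edgeIn (full R) a b))
      ≤⟨ sum²-mono n pointwise ⟩
    edgesIn R ∎
    where
    open ℚₚ.≤-Reasoning
    disjoint : ∀ {p q r} → (p ≡ true → r ≡ true) → (q ≡ true → r ≡ true) →
      (p ≡ true → ¬ (q ≡ true)) → ind p + ind q ≤ℚ ind r
    disjoint {false} {q}     pr qr pq rewrite ℚₚ.+-identityˡ (ind q) = ind-mono qr
    disjoint {true}  {true}  pr qr pq = ⊥-elim (pq refl refl)
    disjoint {true}  {false} pr qr pq rewrite pr refl = ℚₚ.≤-refl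
    pointwise : ∀ a b → ind (atPair x y a b) + ind (edgeIn (full R) a b) ≤ℚ ind (edgeIn R a b)
    pointwise a b = disjoint at⇒R (edgeIn-mono R a b) at⇒¬full
      where
      at⇒R : atPair x y a b ≡ true → edgeIn R a b ≡ true
      at⇒R at with atPair-elim x y a b at
      ... | refl , refl = Rxy
      at⇒¬full : atPair x y a b ≡ true → ¬ (edgeIn (full R) a b ≡ true)
      at⇒¬full at with atPair-elim x y a b at
      ... | refl , refl = ¬fxy

  edgeIn-intro : ∀ R {a b} → ltᵇ a b ≡ true → adj G a b ≡ true → R a ≡ true → R b ≡ true →
    edgeIn R a b ≡ true
  edgeIn-intro R a<b ab Ra Rb = ∧-join (∧-join a<b ab) (∧-join Ra Rb)

  edgeIn-elim : ∀ R a b → edgeIn R a b ≡ true →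
    ltᵇ a b ≡ true × adj G a b ≡ true × R a ≡ true × R b ≡ true
  edgeIn-elim R a b h =
    let e , r = ∧-split {ltᵇ a b ∧ adj G a b} h
        a<b , ab = ∧-split {ltᵇ a b} e
        Ra , Rb = ∧-split {R a} r
    in a<b , ab , Ra , Rb

  edgesIn-partial : ∀ R {a b} → adj G a b ≡ true → R a ≡ true → R b ≡ true → full R a ≡ false →
    1ℚ + edgesIn (full R) ≤ℚ edgesIn R
  edgesIn-partial R {a} {b} ab Ra Rb ¬fa with orient ab
  ... | inj₁ a<b = edgesIn-extra R {a} {b} (edgeIn-intro R a<b ab Ra Rb)
    (λ h → let _ , _ , fa , _ = edgeIn-elim (full R) a b h in true≢false fa ¬fa)
  ... | inj₂ b<a = edgesIn-extra R {b} {a} (edgeIn-intro R b<a (adj-sym ab) Rb Ra)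
    (λ h → let _ , _ , _ , fa = edgeIn-elim (full R) b a h in true≢false fa ¬fa)

  fullCount-none : ∀ R → (∀ u → ¬ (full R u ≡ true)) → fullCount R ≡ 0ℚ
  fullCount-none R none =
    sum-zero n (λ u → cong ind (¬true⇒false (λ h → none u (proj₁ (∧-split h)))))

  module CrossEdges
    (cross    : ∀ {a b} → adj G a b ≡ true → ¬ Same a b)
    (joined   : ∀ {u v} → ¬ Same u v → ∃ λ a → ∃ λ b → Same u a × Same v b × adj G a b ≡ true)
    (oneEdge  : ∀ {a b a′ b′} → adj G a b ≡ true → adj G a′ b′ ≡ true → Same a a′ → Same b b′ →
                a ≡ a′ × b ≡ b′)
    where

    -- The edges joining the component of u₀ to the other full components are pairwise distinct.
    star : ∀ R {u₀} → rep R u₀ ≡ true → fullCount R ≤ℚ 1ℚ + edgesIn (full R)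
    star R {u₀} hu₀ = begin
      fullCount R
        ≤⟨ sum-mono n (λ v → ind-split (rep R v) (eqᵇ v u₀)) ⟩
      sumFin n (λ v → ind (others v) + ind (eqᵇ v u₀))
        ≡⟨ sum-+ n (λ v → ind (others v)) (λ v → ind (eqᵇ v u₀)) ⟩
      sumFin n (λ v → ind (others v)) + sumFin n (λ v → ind (eqᵇ v u₀))
        ≤⟨ ℚₚ.+-mono-≤ (count-by-witness n others (edgeIn (full R)) W witness (λ _ _ _ → proj₁) inj)
                       (ind-sum-≤ n (λ v → eqᵇ v u₀) true (λ _ _ → refl)
                         (λ i j hi hj → trans (eqᵇ⇒≡ hi) (≡.sym (eqᵇ⇒≡ hj)))) ⟩
      edgesIn (full R) + 1ℚ
        ≡⟨ ℚₚ.+-comm (edgesIn (full R)) 1ℚ ⟩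
      1ℚ + edgesIn (full R) ∎
      where
      open ℚₚ.≤-Reasoning
      others : Fin n → Bool
      others v = rep R v ∧ not (eqᵇ v u₀)
      -- Edges are listed from their smaller to their larger end, so either end may be the one in
      -- the component of `u₀`.
      W : Fin n → Fin n → Fin n → Set
      W v a b = edgeIn (full R) a b ≡ true × ((Same u₀ a × Same v b) ⊎ (Same v a × Same u₀ b))
      others-rep : ∀ v → others v ≡ true → rep R v ≡ true
      others-rep v h = proj₁ (∧-split {rep R v} h)
      others-≢ : ∀ v → others v ≡ true → v ≢ u₀
      others-≢ v h refl with proj₂ (∧-split {rep R v} h)
      ... | h′ rewrite ≡⇒eqᵇ {i = v} refl with h′
      ... | ()
      witness : ∀ v → others v ≡ true → ∃ λ a → ∃ λ b → W v a b
      witness v h with joined {u₀} {v} (λ s → others-≢ v h (≡.sym (rep-unique R hu₀ (others-rep v h) s)))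
      ... | a , b , sa , sb , ab
        with full-same R (proj₁ (∧-split hu₀)) sa
           | full-same R (proj₁ (∧-split {full R v} (others-rep v h))) sb
           | orient ab
      ... | fa | fb | inj₁ a<b = a , b , edgeIn-intro (full R) a<b ab fa fb , inj₁ (sa , sb)
      ... | fa | fb | inj₂ b<a = b , a , edgeIn-intro (full R) b<a (adj-sym ab) fb fa , inj₂ (sb , sa)
      inj : ∀ v v′ a b → others v ≡ true → others v′ ≡ true → W v a b → W v′ a b → v ≡ v′
      inj v v′ a b hv hv′ (e , w) (_ , w′) = case w w′
        where
        apart : ¬ Same a b
        apart = cross (proj₁ (proj₂ (edgeIn-elim (full R) a b e)))
        same⇒≡ : Same v v′ → v ≡ v′
        same⇒≡ = rep-unique R (others-rep v hv) (others-rep v′ hv′)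
        case : _ → _ → v ≡ v′
        case (inj₁ (sa , sb)) (inj₁ (sa′ , sb′)) = same⇒≡ (same-trans sb (same-sym sb′))
        case (inj₁ (sa , sb)) (inj₂ (sa′ , sb′)) = ⊥-elim (apart (same-trans (same-sym sa) sb′))
        case (inj₂ (sa , sb)) (inj₁ (sa′ , sb′)) = ⊥-elim (apart (same-trans (same-sym sa′) sb))
        case (inj₂ (sa , sb)) (inj₂ (sa′ , sb′)) = same⇒≡ (same-trans sa (same-sym sa′))

    fullCount-bound : ∀ R {u} → full R u ≡ true → fullCount R ≤ℚ 1ℚ + edgesIn (full R)
    fullCount-bound R h = star R (proj₂ (proj₂ (rep-exists R h)))

    fullCount-valid : ∀ R → fullCount R ≤ℚ 1ℚ + edgesIn R
    fullCount-valid R with Fₚ.any? (λ u → full R u Boolₚ.≟ true)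
    ... | yes (u , h) = ℚₚ.≤-trans (fullCount-bound R h) (ℚₚ.+-monoʳ-≤ 1ℚ (edgesIn-mono R))
    ... | no none = subst (_≤ℚ 1ℚ + edgesIn R) (≡.sym (fullCount-none R (λ u h → none (u , h))))
      (ℚₚ.+-mono-≤ (ℚₚ.nonNegative⁻¹ 1ℚ) (edgesIn-nonneg R))

    -- Without a full component the left side of the root equation is 0, while the right side is at
    -- least 1.
    root-full : ∀ R → Root R → ∃ λ u → full R u ≡ true
    root-full R root = decidable-stable (Fₚ.any? (λ u → full R u Boolₚ.≟ true)) λ none →
      1+x≰x (edgesIn R) (subst (_≤ℚ edgesIn R)
        (trans (≡.sym (fullCount-none R (λ u h → none (u , h)))) root) (edgesIn-nonneg R))

    -- The star bound uses only edges with both ends in full components. Any other edge inside `R`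
    -- makes the inequality strict.
    root-edge : ∀ R → Root R → ∀ {a b} → adj G a b ≡ true → R a ≡ true → R b ≡ true →
      full R a ≡ true
    root-edge R root {a} ab Ra Rb = decidable-stable (full R a Boolₚ.≟ true) λ ¬fa →
      1+x≰x (edgesIn R) (subst (_≤ℚ edgesIn R) root
        (ℚₚ.≤-trans (fullCount-bound R (proj₂ (root-full R root)))
                    (edgesIn-partial R ab Ra Rb (¬true⇒false ¬fa))))

    -- One full component makes the left side at least 1, the right side is exactly 1, and validity
    -- gives the converse bound.
    root-independent : ∀ R {u} → full R u ≡ true →
      (∀ {a b} → R a ≡ true → R b ≡ true → ¬ (adj G a b ≡ true)) → Root R
    root-independent R {u} fu indep = ℚₚ.≤-antisym (fullCount-valid R)
      (subst (λ e → 1ℚ + e ≤ℚ fullCount R) (≡.sym none)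
        (ind-sum-≥1 n (rep R) _ (proj₂ (proj₂ (rep-exists R fu)))))
      where
      none : edgesIn R ≡ 0ℚ
      none = sum-zero n (λ a → sum-zero n (λ b → cong ind (¬true⇒false (λ h →
        let _ , ab , Ra , Rb = edgeIn-elim R a b h in indep Ra Rb ab))))

    -- The left side is at least 2. All edges inside `R` join the same two components, so there is
    -- at most one and the right side is at most 2.
    root-twoFull : ∀ R {u v} → full R u ≡ true → full R v ≡ true → ¬ Same u v →
      (∀ {a b} → R a ≡ true → R b ≡ true → adj G a b ≡ true →
        (Same u a × Same v b) ⊎ (Same v a × Same u b)) → Root R
    root-twoFull R {u} {v} fu fv u≁v between = ℚₚ.≤-antisym (fullCount-valid R)
      (ℚₚ.≤-trans (ℚₚ.+-monoʳ-≤ 1ℚ atMostOne) atLeastTwo)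
      where
      atLeastTwo : two ≤ℚ fullCount R
      atLeastTwo =
        let u′ , su , ru = rep-exists R fu
            v′ , sv , rv = rep-exists R fv
        in ind-sum-≥2 n (rep R) u′ v′
             (λ eq → u≁v (same-trans su (subst (λ w → Same w v) (≡.sym eq) (same-sym sv)))) ru rv
      bound : ∀ x y → (∀ a b → edgeIn R a b ≡ true → a ≡ x × b ≡ y) → edgesIn R ≤ℚ 1ℚ
      bound x y only = ℚₚ.≤-trans
        (sum²-mono n {g = λ a b → ind (atPair x y a b)} (λ a b → ind-mono (λ h →
          ∧-join (≡⇒eqᵇ (proj₁ (only a b h))) (≡⇒eqᵇ (proj₂ (only a b h))))))
        (ℚₚ.≤-reflexive (sum²-atPair n true x y))
      atMostOne : edgesIn R ≤ℚ 1ℚ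
      atMostOne with joined u≁v
      ... | x , y , sx , sy , xy with orient xy
      ... | inj₁ x<y = bound x y only
        where
        only : ∀ a b → edgeIn R a b ≡ true → a ≡ x × b ≡ y
        only a b h with edgeIn-elim R a b h
        ... | a<b , ab , Ra , Rb with between Ra Rb ab
        ... | inj₁ (sa , sb) = oneEdge ab xy (same-trans (same-sym sa) sx) (same-trans (same-sym sb) sy)
        ... | inj₂ (sa , sb)
          with oneEdge (adj-sym ab) xy (same-trans (same-sym sb) sx) (same-trans (same-sym sa) sy)
        ... | refl , refl = ⊥-elim (ℕₚ.<-asym (ltᵇ⇒< a b a<b) (ltᵇ⇒< x y x<y))
      ... | inj₂ y<x = bound y x only
        where
        only : ∀ a b → edgeIn R a b ≡ true → a ≡ y × b ≡ x
        only a b h with edgeIn-elim R a b h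
        ... | a<b , ab , Ra , Rb with between Ra Rb ab
        ... | inj₂ (sa , sb) = oneEdge ab (adj-sym xy) (same-trans (same-sym sa) sy) (same-trans (same-sym sb) sx)
        ... | inj₁ (sa , sb)
          with oneEdge ab xy (same-trans (same-sym sa) sx) (same-trans (same-sym sb) sy)
        ... | refl , refl = ⊥-elim (ℕₚ.<-asym (ltᵇ⇒< a b a<b) (ltᵇ⇒< y x y<x))

    -- Roots made of components and single nodes

    opaque
      comp : Fin n → Fin n → Bool
      comp u v = does (same? u v)

      comp-elim : ∀ {u v} → comp u v ≡ true → Same u v
      comp-elim {u} {v} = does-true⁻¹ (same? u v)

      comp-intro : ∀ {u v} → Same u v → comp u v ≡ true
      comp-intro {u} {v} = dec-true (same? u v)

    full-comp : ∀ u → full (comp u) u ≡ true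
    full-comp u = ∧-join (comp-intro (same-refl {u})) (comp-intro (same-mate {u}))

    full-∪ˡ : ∀ A B {u} → full A u ≡ true → full (A ∪ B) u ≡ true
    full-∪ˡ A B {u} h = let Au , Amu = ∧-split {A u} h in ∧-join (∪-introˡ A B Au) (∪-introˡ A B Amu)

    full-∪ʳ : ∀ A B {u} → full B u ≡ true → full (A ∪ B) u ≡ true
    full-∪ʳ A B {u} h = let Bu , Bmu = ∧-split {B u} h in ∧-join (∪-introʳ A B Bu) (∪-introʳ A B Bmu)

    Touches Apart : Fin n → Fin n → Set
    Touches w u = ∃ λ x → Same u x × adj G w x ≡ true
    Apart   w u = ∀ {x} → Same u x → ¬ (adj G w x ≡ true)

    -- Two components are joined by only one edge, and here that edge already ends at `w`.
    mate-apart : ∀ {w u} → mate w ≢ w → Touches w u → Apart (mate w) u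
    mate-apart ne (x , ux , wx) ux′ mwx′ =
      ne (≡.sym (proj₁ (oneEdge wx mwx′ same-mate (same-trans (same-sym ux) ux′))))

    touches-≁ : ∀ {w u} → Touches w u → ¬ Same u w
    touches-≁ (x , ux , wx) uw = cross wx (same-trans (same-sym uw) ux)

    mate-≁ : ∀ {u w} → ¬ Same u w → ¬ Same u (mate w)
    mate-≁ u≁w s = u≁w (same-trans s (same-sym same-mate))

    comp-noEdge : ∀ {u a b} → comp u a ≡ true → comp u b ≡ true → ¬ (adj G a b ≡ true)
    comp-noEdge {u} ha hb ab = cross ab (same-trans (same-sym (comp-elim ha)) (comp-elim hb))

    apart-noEdge : ∀ {w u a b} → Apart w u → comp u a ≡ true → node w b ≡ true → ¬ (adj G a b ≡ true)
    apart-noEdge {w} {u} {a} {b} apart ha hb ab with node-elim hb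
    ... | refl = apart (comp-elim ha) (adj-sym ab)

    node-noEdge : ∀ {w a b} → node w a ≡ true → node w b ≡ true → ¬ (adj G a b ≡ true)
    node-noEdge {w} {a} {b} ha hb ab with node-elim ha | node-elim hb
    ... | refl | refl = cross ab same-refl

    ∪-noEdge : ∀ A B →
      (∀ {a b} → A a ≡ true → A b ≡ true → ¬ (adj G a b ≡ true)) →
      (∀ {a b} → A a ≡ true → B b ≡ true → ¬ (adj G a b ≡ true)) →
      (∀ {a b} → B a ≡ true → B b ≡ true → ¬ (adj G a b ≡ true)) →
      ∀ {a b} → (A ∪ B) a ≡ true → (A ∪ B) b ≡ true → ¬ (adj G a b ≡ true)
    ∪-noEdge A B AA AB BB ha hb ab with ∪-elim A B ha | ∪-elim A B hb
    ... | inj₁ Aa | inj₁ Ab = AA Aa Ab ab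
    ... | inj₁ Aa | inj₂ Bb = AB Aa Bb ab
    ... | inj₂ Ba | inj₁ Ab = AB Ab Ba (adj-sym ab)
    ... | inj₂ Ba | inj₂ Bb = BB Ba Bb ab

    comp-node-noEdge : ∀ {u w} → Apart w u → ∀ {a b} →
      (comp u ∪ node w) a ≡ true → (comp u ∪ node w) b ≡ true → ¬ (adj G a b ≡ true)
    comp-node-noEdge {u} {w} apart =
      ∪-noEdge (comp u) (node w) comp-noEdge (apart-noEdge apart) node-noEdge

    root-comp : ∀ u → Root (comp u)
    root-comp u = root-independent (comp u) (full-comp u) comp-noEdge

    root-comp-node : ∀ {u w} → Apart w u → Root (comp u ∪ node w)
    root-comp-node {u} {w} apart = root-independent (comp u ∪ node w)
      (full-∪ˡ (comp u) (node w) (full-comp u)) (comp-node-noEdge apart)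

    root-comp-node-node : ∀ {u w w′} → Apart w u → Apart w′ u → ¬ (adj G w w′ ≡ true) →
      Root ((comp u ∪ node w) ∪ node w′)
    root-comp-node-node {u} {w} {w′} apart apart′ ¬ww′ = root-independent _
      (full-∪ˡ (comp u ∪ node w) (node w′) (full-∪ˡ (comp u) (node w) (full-comp u)))
      (∪-noEdge (comp u ∪ node w) (node w′) (comp-node-noEdge apart) mixed node-noEdge)
      where
      mixed : ∀ {a b} → (comp u ∪ node w) a ≡ true → node w′ b ≡ true → ¬ (adj G a b ≡ true)
      mixed {a} {b} ha hb ab with ∪-elim (comp u) (node w) ha
      ... | inj₁ ua = apart-noEdge apart′ ua hb ab
      ... | inj₂ wa with node-elim wa | node-elim hb
      ... | refl | refl = ¬ww′ ab

    between-comps : ∀ {u v a b} → (comp u ∪ comp v) a ≡ true → (comp u ∪ comp v) b ≡ true →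
      adj G a b ≡ true → (Same u a × Same v b) ⊎ (Same v a × Same u b)
    between-comps {u} {v} ha hb ab with ∪-elim (comp u) (comp v) ha | ∪-elim (comp u) (comp v) hb
    ... | inj₁ ua | inj₁ ub = ⊥-elim (comp-noEdge ua ub ab)
    ... | inj₁ ua | inj₂ vb = inj₁ (comp-elim ua , comp-elim vb)
    ... | inj₂ va | inj₁ ub = inj₂ (comp-elim va , comp-elim ub)
    ... | inj₂ va | inj₂ vb = ⊥-elim (comp-noEdge va vb ab)

    root-comp-comp : ∀ {u v} → ¬ Same u v → Root (comp u ∪ comp v)
    root-comp-comp {u} {v} u≁v = root-twoFull (comp u ∪ comp v)
      (full-∪ˡ (comp u) (comp v) (full-comp u)) (full-∪ʳ (comp u) (comp v) (full-comp v)) u≁v between-comps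

    root-comp-comp-node : ∀ {u v w} → ¬ Same u v → Apart w u → Apart w v →
      Root ((comp u ∪ comp v) ∪ node w)
    root-comp-comp-node {u} {v} {w} u≁v wu wv = root-twoFull _
      (full-∪ˡ (comp u ∪ comp v) (node w) (full-∪ˡ (comp u) (comp v) (full-comp u)))
      (full-∪ˡ (comp u ∪ comp v) (node w) (full-∪ʳ (comp u) (comp v) (full-comp v)))
      u≁v between
      where
      mixed : ∀ {a b} → (comp u ∪ comp v) a ≡ true → node w b ≡ true → ¬ (adj G a b ≡ true)
      mixed ha hb with ∪-elim (comp u) (comp v) ha
      ... | inj₁ ua = apart-noEdge wu ua hb
      ... | inj₂ va = apart-noEdge wv va hb
      between : ∀ {a b} → ((comp u ∪ comp v) ∪ node w) a ≡ true → ((comp u ∪ comp v) ∪ node w) b ≡ true →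
        adj G a b ≡ true → (Same u a × Same v b) ⊎ (Same v a × Same u b)
      between ha hb ab with ∪-elim (comp u ∪ comp v) (node w) ha | ∪-elim (comp u ∪ comp v) (node w) hb
      ... | inj₁ Aa | inj₁ Ab = between-comps Aa Ab ab
      ... | inj₁ Aa | inj₂ wb = ⊥-elim (mixed Aa wb ab)
      ... | inj₂ wa | inj₁ Ab = ⊥-elim (mixed Ab wa (adj-sym ab))
      ... | inj₂ wa | inj₂ wb = ⊥-elim (node-noEdge wa wb ab)

    comp-disjoint : ∀ {u v} → ¬ Same u v → Disjoint (comp u) (comp v)
    comp-disjoint {u} {v} u≁v x ux vx = u≁v (same-trans (comp-elim ux) (same-sym (comp-elim vx)))

    comp-node-disjoint : ∀ {u w} → ¬ Same u w → Disjoint (comp u) (node w)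
    comp-node-disjoint {u} u≁w = node-disjoint (comp u) (λ h → u≁w (comp-elim h))

    node-node-disjoint : ∀ {u v : Fin n} → u ≢ v → Disjoint (node u) (node v)
    node-node-disjoint {u} {v} u≢v = node-disjoint (node u) (λ h → u≢v (≡.sym (node-elim h)))

    comp-single : ∀ {u} → mate u ≡ u → ∀ v → comp u v ≡ node u v
    comp-single {u} eq v = bool-ext (λ h → node-intro (collapse (comp-elim h)))
                                    (λ h → comp-intro (inj₁ (node-elim h)))
      where
      collapse : Same u v → v ≡ u
      collapse (inj₁ v≡u) = v≡u
      collapse (inj₂ v≡m) = trans v≡m eq

    comp-pair : ∀ u v → comp u v ≡ (node u ∪ node (mate u)) v
    comp-pair u v = bool-ext (λ h → to (comp-elim h)) (λ h → comp-intro (from (∪-elim (node u) (node (mate u)) h)))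
      where
      to : Same u v → (node u ∪ node (mate u)) v ≡ true
      to (inj₁ eq) = ∪-introˡ (node u) (node (mate u)) (node-intro eq)
      to (inj₂ eq) = ∪-introʳ (node u) (node (mate u)) (node-intro eq)
      from : node u v ≡ true ⊎ node (mate u) v ≡ true → Same u v
      from (inj₁ h) = inj₁ (node-elim h)
      from (inj₂ h) = inj₂ (node-elim h)

    -- Forms that vanish on all roots when every degree is at least two

    module _ (another : ∀ u x → ∃ λ y → y ≢ x × adj G u y ≡ true)
      {L : Vect (suc n) → ℚ} (hL : IsLinear L)
      (φ-root : ∀ R → Root R → CutForm.φ hL R ≡ 0ℚ)
      where

      open CutForm hL

      φ-comp : ∀ u → φ (comp u) ≡ 0ℚ
      φ-comp u = φ-root (comp u) (root-comp u)

      φ-mate : ∀ {w u} → mate w ≢ w → Touches w u → φ (node (mate w)) ≡ two * β (comp u) (node (mate w))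
      φ-mate {w} {u} ne t = φ-∪-null (comp-node-disjoint (mate-≁ (touches-≁ t)))
        (φ-root _ (root-comp-node (mate-apart ne t))) (φ-comp u)

      -- With b(A) = 2 β(A, mate w), two components V_u, V_v touched by w give
      -- φ(mate w) = b(V_u) = b(V_v) = b(V_u ∪ V_v) = b(V_u) + b(V_v).
      φ-mate-null : ∀ w → mate w ≢ w → φ (node (mate w)) ≡ 0ℚ
      φ-mate-null w ne with another w w
      ... | u , _ , wu with another w u
      ... | v , v≢u , wv = double (φ (node (mate w))) (begin
        φ (node (mate w))
          ≡⟨ φ-∪-null (∪-disjoint {A = comp u} (comp-node-disjoint (mate-≁ (touches-≁ tu)))
                                                (comp-node-disjoint (mate-≁ (touches-≁ tv))))
               (φ-root _ (root-comp-comp-node u≁v (mate-apart ne tu) (mate-apart ne tv)))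
               (φ-root _ (root-comp-comp u≁v)) ⟩
        two * β (comp u ∪ comp v) (node (mate w))
          ≡⟨ cong (two *_) (β-∪ (node (mate w)) (comp-disjoint u≁v)) ⟩
        two * (β (comp u) (node (mate w)) + β (comp v) (node (mate w)))
          ≡⟨ ℚₚ.*-distribˡ-+ two (β (comp u) (node (mate w))) (β (comp v) (node (mate w))) ⟩
        two * β (comp u) (node (mate w)) + two * β (comp v) (node (mate w))
          ≡⟨ cong₂ _+_ (≡.sym (φ-mate ne tu)) (≡.sym (φ-mate ne tv)) ⟩
        φ (node (mate w)) + φ (node (mate w)) ∎)
        where
        open ≡-Reasoning
        tu : Touches w u
        tu = u , same-refl , wu
        tv : Touches w v
        tv = v , same-refl , wv
        u≁v : ¬ Same u v
        u≁v s = v≢u (≡.sym (proj₂ (oneEdge wu wv same-refl s)))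
        double : ∀ x → x ≡ x + x → x ≡ 0ℚ
        double x h = trans (cancel x) (trans (cong (_- x) (≡.sym h)) (ℚₚ.+-inverseʳ x))
          where
          cancel : ∀ x → x ≡ x + x - x
          cancel = solve-∀ ℚ-ring

      mate-≢ : ∀ {w} → mate w ≢ w → mate (mate w) ≢ mate w
      mate-≢ {w} ne eq = ne (trans (≡.sym eq) (mate-mate w))

      -- A single-node component is itself a root, and a node of a pair is the mate of its mate.
      φ-node : ∀ w → φ (node w) ≡ 0ℚ
      φ-node w with mate w Fₚ.≟ w
      ... | yes eq = trans (≡.sym (φ-cong (comp-single eq))) (φ-comp w)
      ... | no ne  = subst (λ z → φ (node z) ≡ 0ℚ) (mate-mate w) (φ-mate-null (mate w) (mate-≢ ne))

      β-comp-mate : ∀ {w u} → mate w ≢ w → Touches w u → β (comp u) (node (mate w)) ≡ 0ℚ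
      β-comp-mate {w} ne t = half _ (trans (≡.sym (φ-mate ne t)) (φ-node (mate w)))

      β-comp-comp : ∀ {u v} → ¬ Same u v → β (comp u) (comp v) ≡ 0ℚ
      β-comp-comp {u} {v} u≁v =
        β-null (comp-disjoint u≁v) (φ-root _ (root-comp-comp u≁v)) (φ-comp u) (φ-comp v)

      -- If the edge between the two components ends at `mate w`, then `β-comp-mate` applies to `w`.
      -- If it ends at `w`, it applies to `mate w`, and `β-comp-comp` leaves the share of `w` equal
      -- to zero.
      β-node-comp : ∀ {u w} → ¬ Same u w → β (node w) (comp u) ≡ 0ℚ
      β-node-comp {u} {w} u≁w with mate w Fₚ.≟ w
      ... | yes eq = trans (≡.sym (β-cong (comp-single eq))) (β-comp-comp (λ s → u≁w (same-sym s)))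
      ... | no ne with joined (λ s → u≁w (same-sym s))
      ... | a , x , inj₂ refl , ux , ax = trans (β-sym (node w) (comp u))
        (subst (λ z → β (comp u) (node z) ≡ 0ℚ) (mate-mate w) (β-comp-mate (mate-≢ ne) (x , ux , ax)))
      ... | a , x , inj₁ refl , ux , ax = β-complement {node (mate w)} {node w} (comp u)
        (node-node-disjoint ne)
        (trans (β-cong {B = comp u} (λ v → trans (∪-comm (node (mate w)) (node w) v) (≡.sym (comp-pair w v))))
               (β-comp-comp (λ s → u≁w (same-sym s))))
        (trans (β-sym (node (mate w)) (comp u)) (β-comp-mate ne (x , ux , ax)))

      Null : Fin n → Fin n → Set
      Null u v = β (node u) (node v) ≡ 0ℚ

      null-sym : ∀ {u v} → Null u v → Null v u
      null-sym {u} {v} h = trans (β-sym (node v) (node u)) h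

      null-mateˡ : ∀ {u v} → ¬ Same u v → Null u v → Null (mate u) v
      null-mateˡ {u} {v} u≁v h with mate u Fₚ.≟ u
      ... | yes eq = subst (λ z → Null z v) (≡.sym eq) h
      ... | no ne  = β-complement (node v) (node-node-disjoint (λ eq → ne (≡.sym eq)))
        (trans (≡.sym (β-cong (comp-pair u)))
          (trans (β-sym (comp u) (node v)) (β-node-comp u≁v))) h

      null-sameˡ : ∀ {u v x} → ¬ Same u v → Same u x → Null u v → Null x v
      null-sameˡ u≁v (inj₁ refl) h = h
      null-sameˡ u≁v (inj₂ refl) h = null-mateˡ u≁v h

      -- For two components, the matrix of β between their nodes has zero row and column sums by
      -- `β-node-comp`, so one zero entry makes all entries zero.
      null-same : ∀ {u v x y} → ¬ Same u v → Same u x → Same v y → Null u v → Null x y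
      null-same {u} {v} {x} {y} u≁v ux vy h = null-sameˡ (λ s → u≁v (same-trans s (same-sym vy))) ux
        (null-sym {y} {u} (null-sameˡ {v} {u} {y} (λ s → u≁v (same-sym s)) vy (null-sym {u} {v} h)))

      null-single : ∀ {u v} → mate u ≡ u → ¬ Same u v → Null u v
      null-single {u} {v} eq u≁v = trans (≡.sym (β-cong (comp-single eq)))
        (trans (β-sym (comp u) (node v)) (β-node-comp u≁v))

      -- For an edge ab, a second neighbour i of a, and the node c of the component of b
      -- that is joined to the component of i, the set V_i ∪ {mate a, mate c} is a root.
      null-edge : ∀ {a b} → adj G a b ≡ true → ∃ λ c → Same b c × Null (mate a) (mate c)
      null-edge {a} {b} ab with another a b
      ... | i , i≢b , ai with joined {b} {i} b≁i
        where
        b≁i : ¬ Same b i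
        b≁i s = i≢b (≡.sym (proj₂ (oneEdge ab ai same-refl s)))
      ... | c , d , bc , id , cd = c , bc , null
        where
        a≁b : ¬ Same a b
        a≁b = cross ab
        ma≁mc : ¬ Same (mate a) (mate c)
        ma≁mc s = a≁b (same-trans same-mate (same-trans s (same-trans (same-sym same-mate) (same-sym bc))))
        tc : Touches c i
        tc = d , id , cd
        ta : Touches a i
        ta = i , same-refl , ai
        null : Null (mate a) (mate c)
        null with mate a Fₚ.≟ a | mate c Fₚ.≟ c
        ... | yes eq | _      = null-single (trans (mate-mate a) (≡.sym eq)) ma≁mc
        ... | no _   | yes eq = null-sym {mate c} (null-single (trans (mate-mate c) (≡.sym eq)) (λ s → ma≁mc (same-sym s)))
        ... | no na  | no nc  = β-complement {comp i} (node (mate c))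
          (comp-node-disjoint i≁ma)
          (β-null (∪-disjoint {A = comp i} (comp-node-disjoint (mate-≁ (touches-≁ tc)))
                    (node-node-disjoint (λ eq → ma≁mc (inj₁ (≡.sym eq)))))
            (φ-root _ (root-comp-node-node (mate-apart na ta) (mate-apart nc tc) noEdge))
            (φ-root _ (root-comp-node (mate-apart na ta)))
            (φ-node (mate c)))
          (β-comp-mate nc tc)
          where
          i≁ma : ¬ Same i (mate a)
          i≁ma = mate-≁ (touches-≁ ta)
          -- Such an edge would be a second one between the components of `a` and `b`.
          noEdge : ¬ (adj G (mate a) (mate c) ≡ true)
          noEdge h = na (≡.sym (proj₁ (oneEdge ab h same-mate (same-trans bc same-mate))))

      -- Inside a component, φ vanishes at both nodes and at their union. Between two components,
      -- the one zero entry found by `null-edge` spreads to all.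
      β-node-node : ∀ u v → u ≢ v → Null u v
      β-node-node u v u≢v with same? u v
      ... | yes (inj₁ v≡u)  = ⊥-elim (u≢v (≡.sym v≡u))
      ... | yes (inj₂ refl) = β-null (node-node-disjoint u≢v)
        (trans (≡.sym (φ-cong (comp-pair u))) (φ-comp u)) (φ-node u) (φ-node (mate u))
      ... | no u≁v with joined u≁v
      ... | a , b , ua , vb , ab with null-edge ab
      ... | c , bc , null = null-same
        (λ s → u≁v (same-trans ua′ (same-trans s (same-sym vc′)))) (same-sym ua′) (same-sym vc′) null
        where
        ua′ : Same u (mate a)
        ua′ = same-trans ua same-mate
        vc′ : Same v (mate c)
        vc′ = same-trans vb (same-trans bc same-mate)

-- Components of a graph with node-disjoint edges

module _ {n : ℕ} (H : Graph n) where

  mateOf : Fin n → Fin n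
  mateOf u with Fₚ.any? (λ v → adj H u v Boolₚ.≟ true)
  ... | yes (v , _) = v
  ... | no _        = u

  mateOf-cases : ∀ u → (mateOf u ≡ u × (∀ v → adj H u v ≡ false)) ⊎ adj H u (mateOf u) ≡ true
  mateOf-cases u with Fₚ.any? (λ v → adj H u v Boolₚ.≟ true)
  ... | yes (v , uv) = inj₂ uv
  ... | no none      = inj₁ (refl , λ v → ¬true⇒false (λ uv → none (v , uv)))

  mateOf-adj : ∀ {u} → mateOf u ≢ u → adj H u (mateOf u) ≡ true
  mateOf-adj {u} ne with mateOf-cases u
  ... | inj₁ (eq , _) = ⊥-elim (ne eq)
  ... | inj₂ h        = h

  module _ (matching : Matching H) where

    adj⇒mateOf : ∀ {u v} → adj H u v ≡ true → v ≡ mateOf u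
    adj⇒mateOf {u} {v} uv with mateOf-cases u
    ... | inj₁ (_ , none) = ⊥-elim (true≢false uv (none v))
    ... | inj₂ h          = matching u v (mateOf u) uv h

    mateOf-mateOf : ∀ u → mateOf (mateOf u) ≡ u
    mateOf-mateOf u with mateOf-cases u
    ... | inj₁ (eq , _) = trans (cong mateOf eq) eq
    ... | inj₂ h        = ≡.sym (adj⇒mateOf (trans (Graph.sym H (mateOf u) u) h))

    open Components H mateOf mateOf-mateOf using (Same; same-trans)

    -- Each edge of a matching leads to the mate and the next one leads back, so no walk leaves the
    -- pair.
    reach⇒same : ∀ k u v → reach H k u v ≡ true → Same u v
    reach⇒same zero    u v h = inj₁ (≡.sym (eqᵇ⇒≡ h))
    reach⇒same (suc k) u v h with reach H k u v in eq
    ... | true  = reach⇒same k u v eq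
    ... | false =
      let w , hw = anyFin-elim n _ h
          uw , wv = ∧-split {reach H k u w} hw
      in same-trans (reach⇒same k u w uw) (inj₂ (adj⇒mateOf wv))

    reach-refl : ∀ k u → reach H k u u ≡ true
    reach-refl zero    u = ≡⇒eqᵇ {i = u} refl
    reach-refl (suc k) u rewrite reach-refl k u = refl

    reach-adj : ∀ k {u v} → adj H u v ≡ true → reach H (suc k) u v ≡ true
    reach-adj k {u} {v} uv
      rewrite anyFin-intro n (λ w → reach H k u w ∧ adj H w v) u (∧-join (reach-refl k u) uv) =
      ∨-zeroʳ (reach H k u v)

    sameComp⇒same : ∀ {u v} → SameComp H u v → Same u v
    sameComp⇒same {u} {v} = reach⇒same n u v

    -- The mate is one step away, and `reach` over `n` steps allows a step because n is positive.
    same⇒sameComp : 1 ≤ n → ∀ {u v} → Same u v → SameComp H u v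
    same⇒sameComp _ (inj₁ refl) = reach-refl n _
    same⇒sameComp (s≤s {n = k} _) {u} (inj₂ refl) with mateOf-cases u
    ... | inj₁ (eq , _) = trans (cong (reach H (suc k) u) eq) (reach-refl (suc k) u)
    ... | inj₂ h        = reach-adj k h

    singletonᵇ-mateOf : 1 ≤ n → ∀ u → singletonᵇ H u ≡ eqᵇ (mateOf u) u
    singletonᵇ-mateOf 1≤n u = bool-ext to from
      where
      to : singletonᵇ H u ≡ true → eqᵇ (mateOf u) u ≡ true
      to h with allFin-elim n _ h (mateOf u)
      ... | h′ rewrite same⇒sameComp 1≤n {u} {mateOf u} (inj₂ refl) = ≡⇒eqᵇ (≡.sym (eqᵇ⇒≡ {i = u} {mateOf u} h′))
      from : eqᵇ (mateOf u) u ≡ true → singletonᵇ H u ≡ true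
      from h = allFin-intro n _ λ v → implies (λ r → ≡⇒eqᵇ (≡.sym (collapse (sameComp⇒same r))))
        where
        implies : ∀ {a b} → (a ≡ true → b ≡ true) → not a ∨ b ≡ true
        implies {true}  f = f refl
        implies {false} f = refl
        collapse : ∀ {v} → Same u v → v ≡ u
        collapse (inj₁ eq) = eq
        collapse (inj₂ eq) = trans eq (eqᵇ⇒≡ h)

-- The inequality evaluated at cut vectors

coord-cutVec : ∀ {N} (S : Subset N) u v → coord (cutVec S) u v ≡ ind (xorᵇ (S u) (S v))
coord-cutVec S u v with u F.<? v | v F.<? u
... | yes _  | _     = refl
... | no _   | yes _ = cong ind (xor-comm (S v) (S u))
  where
  xor-comm : ∀ a b → xorᵇ a b ≡ xorᵇ b a
  xor-comm true  true  = refl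
  xor-comm true  false = refl
  xor-comm false true  = refl
  xor-comm false false = refl
-- The default value 0 of `coord` at equal nodes is right for cuts, which never separate a node from
-- itself.
... | no u≮v | no v≮u = ≡.sym (trans (cong (λ w → ind (xorᵇ (S u) (S w))) v≡u) (xor-self (S u)))
  where
  v≡u : v ≡ u
  v≡u = Fₚ.toℕ-injective (ℕₚ.≤-antisym (ℕₚ.≮⇒≥ u≮v) (ℕₚ.≮⇒≥ v≮u))
  xor-self : ∀ a → ind (xorᵇ a a) ≡ 0ℚ
  xor-self true  = refl
  xor-self false = refl

-- As a cut vector does not change under complementation, every cut of K_{n+1} is
-- given by the set R ⊆ V of the nodes separated from n+1.
module _ {n : ℕ} (S : Subset (suc n)) (R : Fin n → Bool)
  (R≡ : ∀ u → R u ≡ xorᵇ (S (inject₁ u)) (S (fromℕ n))) where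

  coord-root : ∀ u → coord (cutVec S) (inject₁ u) (fromℕ n) ≡ ind (R u)
  coord-root u = trans (coord-cutVec S (inject₁ u) (fromℕ n)) (cong ind (≡.sym (R≡ u)))

  -- If both nodes are separated from n+1, the value is 0 - 1 - 1. If only one is, the edge `uv` is
  -- cut as well and the terms cancel.
  T-cutVec : ∀ u v → T (cutVec S) u v ≡ - two * ind (R u ∧ R v)
  T-cutVec u v
    rewrite coord-cutVec S (inject₁ u) (inject₁ v) | coord-cutVec S (inject₁ u) (fromℕ n)
          | coord-cutVec S (inject₁ v) (fromℕ n) | R≡ u | R≡ v =
    bool-cases (S (inject₁ u)) (S (inject₁ v)) (S (fromℕ n))
    where
    bool-cases : ∀ a b c → ind (xorᵇ a b) - ind (xorᵇ a c) - ind (xorᵇ b c)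
      ≡ - two * ind (xorᵇ a c ∧ xorᵇ b c)
    bool-cases true  true  true  = refl
    bool-cases true  true  false = refl
    bool-cases true  false true  = refl
    bool-cases true  false false = refl
    bool-cases false true  true  = refl
    bool-cases false true  false = refl
    bool-cases false false true  = refl
    bool-cases false false false = refl

  graphEdges-cutVec : ∀ (G : Graph n) → sumGraphEdges G (T (cutVec S))
    ≡ - two * sum² n (λ u v → ind ((ltᵇ u v ∧ adj G u v) ∧ (R u ∧ R v)))
  graphEdges-cutVec G = trans
    (sum-cong n (λ u → trans
      (sum-cong n (λ v → guard (ltᵇ u v ∧ adj G u v) (T-cutVec u v)))
      (sum-* n (- two) _)))
    (sum-* n (- two) _)
    where
    guard : ∀ c {t r} → t ≡ - two * ind r → (if c then t else 0ℚ) ≡ - two * ind (c ∧ r)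
    guard true  eq = eq
    guard false eq = refl

  module _ (G H : Graph n) (matching : Matching H) (1≤n : 1 ≤ n) where
    open Components G (mateOf H) (mateOf-mateOf H matching)

    -- This is why the inequality has its last sum: a pair inside `R` is counted through its edge of
    -- `H`, at the smaller node, and a single-node component has no such edge.
    rep-sum : ∀ u → sumFin n (λ v → ind ((ltᵇ u v ∧ adj H u v) ∧ (R u ∧ R v)))
        + (if singletonᵇ H u then coord (cutVec S) (inject₁ u) (fromℕ n) else 0ℚ)
      ≡ ind (rep R u)
    rep-sum u rewrite singletonᵇ-mateOf H matching 1≤n u | coord-root u =
      trans (cong (_+ (if eqᵇ m u then ind (R u) else 0ℚ)) (sum-single n _ m off)) at-mate
      where
      m = mateOf H u
      off : ∀ v → v ≢ m → ind ((ltᵇ u v ∧ adj H u v) ∧ (R u ∧ R v)) ≡ 0ℚ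
      off v v≢m = cong ind (¬true⇒false (λ h →
        v≢m (adj⇒mateOf H matching (proj₂ (∧-split {ltᵇ u v} (proj₁ (∧-split {ltᵇ u v ∧ adj H u v} h)))))))
      at-mate : ind ((ltᵇ u m ∧ adj H u m) ∧ (R u ∧ R m)) + (if eqᵇ m u then ind (R u) else 0ℚ)
        ≡ ind ((R u ∧ R m) ∧ not (ltᵇ m u))
      at-mate with Fₚ.<-cmp u m
      ... | tri< u<m u≢m u≯m
        rewrite dec-true (u F.<? m) u<m | mateOf-adj H {u} (λ eq → u≢m (≡.sym eq))
              | dec-false (m Fₚ.≟ u) (λ eq → u≢m (≡.sym eq)) | dec-false (m F.<? u) u≯m =
        case (R u ∧ R m)
        where
        case : ∀ r → ind r + 0ℚ ≡ ind (r ∧ true)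
        case true  = refl
        case false = refl
      ... | tri≈ u≮m u≡m u≯m
        rewrite dec-false (u F.<? m) u≮m | dec-false (m F.<? u) u≯m
              | dec-true (m Fₚ.≟ u) (≡.sym u≡m) | ≡.sym (cong R u≡m) =
        case (R u)
        where
        case : ∀ r → 0ℚ + ind r ≡ ind ((r ∧ r) ∧ true)
        case true  = refl
        case false = refl
      ... | tri> u≮m u≢m u>m
        rewrite dec-false (u F.<? m) u≮m | dec-true (m F.<? u) u>m
              | dec-false (m Fₚ.≟ u) (λ eq → u≢m (≡.sym eq)) =
        case (R u ∧ R m)
        where
        case : ∀ r → 0ℚ + 0ℚ ≡ ind (r ∧ false)
        case true  = refl
        case false = refl

    lhsI-cutVec : lhsI G H (cutVec S) ≡ two * (fullCount R - edgesIn R)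
    lhsI-cutVec = begin
      sumGraphEdges G (T (cutVec S)) - sumGraphEdges H (T (cutVec S)) + two * singles
        ≡⟨ cong₂ (λ g h → g - h + two * singles) (graphEdges-cutVec G) (graphEdges-cutVec H) ⟩
      - two * edgesIn R - - two * pairs + two * singles
        ≡⟨ collect two (edgesIn R) pairs singles ⟩
      two * (pairs + singles - edgesIn R)
        ≡⟨ cong (λ c → two * (c - edgesIn R)) (trans (≡.sym (sum-+ n _ _)) (sum-cong n rep-sum)) ⟩
      two * (fullCount R - edgesIn R) ∎
      where
      open ≡-Reasoning
      singles = sumFin n (λ u → if singletonᵇ H u then coord (cutVec S) (inject₁ u) (fromℕ n) else 0ℚ)
      pairs   = sum² n (λ u v → ind ((ltᵇ u v ∧ adj H u v) ∧ (R u ∧ R v)))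
      collect : ∀ t e p s → - t * e - - t * p + t * s ≡ t * (p + s - e)
      collect = solve-∀ ℚ-ring

    lhsI-valid : fullCount R ≤ℚ 1ℚ + edgesIn R → lhsI G H (cutVec S) ≤ℚ two
    lhsI-valid h = subst₂ _≤ℚ_ (≡.sym lhsI-cutVec) (ℚₚ.*-identityʳ two)
      (ℚₚ.*-monoˡ-≤-nonNeg two (subst (fullCount R - edgesIn R ≤ℚ_) (cancel (edgesIn R))
        (ℚₚ.+-monoˡ-≤ (- edgesIn R) h)))
      where
      cancel : ∀ x → 1ℚ + x - x ≡ 1ℚ
      cancel = solve-∀ ℚ-ring

    root⇒lhsI : Root R → lhsI G H (cutVec S) ≡ two
    root⇒lhsI root = trans lhsI-cutVec
      (trans (cong (λ c → two * (c - edgesIn R)) root) (cancel (edgesIn R)))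
      where
      cancel : ∀ x → two * (1ℚ + x - x) ≡ two
      cancel = solve-∀ ℚ-ring

    lhsI⇒root : lhsI G H (cutVec S) ≡ two → Root R
    lhsI⇒root h = begin
      fullCount R
        ≡⟨ halve (fullCount R) (edgesIn R) ⟩
      ½ * (two * (fullCount R - edgesIn R)) + edgesIn R
        ≡⟨ cong (λ t → ½ * t + edgesIn R) (trans (≡.sym lhsI-cutVec) h) ⟩
      1ℚ + edgesIn R ∎
      where
      open ≡-Reasoning
      halve : ∀ x y → x ≡ ½ * (two * (x - y)) + y
      halve x y = trans (shift x y)
        (cong (_+ y) (trans (≡.sym (ℚₚ.*-identityˡ (x - y))) (ℚₚ.*-assoc ½ two (x - y))))
        where
        shift : ∀ x y → x ≡ x - y + y
        shift = solve-∀ ℚ-ring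

T-linear : ∀ {n} (u v : Fin n) → IsLinear (λ x → T x u v)
T-linear {n} u v = linear--
  (linear-- (linear-coord (inject₁ u) (inject₁ v)) (linear-coord (inject₁ u) (fromℕ n)))
  (linear-coord (inject₁ v) (fromℕ n))

lhsI-linear : ∀ {n} (G H : Graph n) → IsLinear (lhsI G H)
lhsI-linear {n} G H =
  linear-+ (linear-- (edges G) (edges H))
    (linear-* two (linear-sum n (λ u → linear-if (singletonᵇ H u) (linear-coord (inject₁ u) (fromℕ n)))))
  where
  edges : ∀ (G : Graph n) → IsLinear (λ x → sumGraphEdges G (T x))
  edges G = linear-sum n (λ u → linear-sum n (λ v → linear-if (ltᵇ u v ∧ adj G u v) (T-linear u v)))

-- The two directions of the equivalence

covered⇒≤ : ∀ {n k} (g : Vec (Fin n) k) → (∀ v → ∃ λ i → lookup g i ≡ v) → n ≤ k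
covered⇒≤ g cover = Fₚ.injective⇒≤ {f = λ v → proj₁ (cover v)} λ {v} {v′} eq →
  trans (≡.sym (proj₂ (cover v))) (trans (cong (lookup g) eq) (proj₂ (cover v′)))

module Theorem {n : ℕ} (1≤n : 1 ≤ n) (G H : Graph n) (matching : Matching H) (edgeCond : EdgeCond G H) where

  mate : Fin n → Fin n
  mate = mateOf H

  open Components G mate (mateOf-mateOf H matching)

  cross : ∀ {a b} → adj G a b ≡ true → ¬ Same a b
  cross {a} {b} ab s = proj₁ edgeCond a b ab (same⇒sameComp H matching 1≤n s)

  joined : ∀ {u v} → ¬ Same u v → ∃ λ a → ∃ λ b → Same u a × Same v b × adj G a b ≡ true
  joined {u} {v} u≁v =
    let a , b , ua , vb , ab = proj₁ (proj₂ edgeCond) u v (λ s → u≁v (sameComp⇒same H matching s))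
    in a , b , sameComp⇒same H matching ua , sameComp⇒same H matching vb , ab

  oneEdge : ∀ {a b a′ b′} → adj G a b ≡ true → adj G a′ b′ ≡ true → Same a a′ → Same b b′ →
    a ≡ a′ × b ≡ b′
  oneEdge {a} {b} {a′} {b′} ab a′b′ aa′ bb′ = proj₁ (proj₂ (proj₂ edgeCond) a b a′ b′ ab a′b′)
    (same⇒sameComp H matching 1≤n aa′) (same⇒sameComp H matching 1≤n bb′)

  open CrossEdges cross joined oneEdge

  f : Vect (suc n) → ℚ
  f = lhsI G H

  f-linear : IsLinear f
  f-linear = lhsI-linear G H

  separated : Subset (suc n) → Fin n → Bool
  separated S u = xorᵇ (S (inject₁ u)) (S (fromℕ n))

  f-valid : ∀ S → f (cutVec S) ≤ℚ two
  f-valid S = lhsI-valid S (separated S) (λ _ → refl) G H matching 1≤n (fullCount-valid (separated S))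

  empty : Fin n → Bool
  empty _ = false

  origin : Vect (suc n)
  origin = cutVec (avoid empty)

  f-origin : f origin ≢ two
  f-origin eq = true≢false (proj₂ (root-full empty
    (lhsI⇒root (avoid empty) empty (avoid-xor empty) G H matching 1≤n eq))) refl

  degree-two⇒facet : (∀ u → 2 ≤ degree G u) → Facet (InCut (suc n)) f two
  degree-two⇒facet deg = facet-criterion {P = InCut (suc n)} {f} {two} f-linear (ℕₚ.≤-trans 1≤n (ℕₚ.m≤m+n n (edgeSize n)))
    (cut-valid {f = f} f-linear f-valid) origin (cutVec-inCut (avoid empty)) f-origin separate
    where
    separate : ∀ a → (∃ λ k → a k ≢ 0ℚ) → Σ (Vect (suc n)) λ q → (InCut (suc n) q × f q ≡ two) × form a q ≢ 0ℚ
    -- There are finitely many subsets, so a root where the form is nonzero is found by search. If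
    -- the search fails, the form vanishes on all roots and is therefore zero.
    separate a (k , ak≢0) with Subₚ.anySubset? (λ s →
      (f (cutVec (avoid (lookup s))) ℚₚ.≟ two) ×-dec ¬? (form a (cutVec (avoid (lookup s))) ℚₚ.≟ 0ℚ))
    ... | yes (s , fq , aq) = cutVec (avoid (lookup s)) , (cutVec-inCut (avoid (lookup s)) , fq) , aq
    ... | no none = ⊥-elim (ak≢0 (form-null a
          (φ-node another {form a} (form-linear a) φ-root) (β-node-node another {form a} (form-linear a) φ-root) k))
      where
      another : ∀ u x → ∃ λ y → y ≢ x × adj G u y ≡ true
      another u x = count-another n (adj G u) (deg u) x
      φ-root : ∀ R → Root R → CutForm.φ {L = form a} (form-linear a) R ≡ 0ℚ
      φ-root R root = trans (CutForm.φ-cong {L = form a} (form-linear a) (λ u → ≡.sym (lookup∘tabulate R u)))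
        (decidable-stable (form a (cutVec (avoid (lookup (tabulate R)))) ℚₚ.≟ 0ℚ) λ ne →
          none (tabulate R , trans (CutForm.φ-cong {L = f} f-linear (lookup∘tabulate R))
            (root⇒lhsI (avoid R) R (avoid-xor R) G H matching 1≤n root) , ne))

  -- Two components besides {u} would give u two neighbours.
  single-degree : 3 ≤ kOf H → ∀ u → (∀ {x y} → adj G u x ≡ true → adj G u y ≡ true → x ≡ y) → mate u ≢ u
  single-degree 3≤k u unique single = ℕₚ.<⇒≱ 3≤k k≤2
    where
    neighbour : ∀ v → ¬ Same u v → ∃ λ b → Same v b × adj G u b ≡ true
    neighbour v u≁v with joined u≁v
    ... | a , b , inj₁ refl , vb , ab = b , vb , ab
    ... | a , b , inj₂ refl , vb , ab = b , vb , subst (λ a → adj G a b ≡ true) single ab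
    collapse : ∀ {v} → Same u v → v ≡ u
    collapse (inj₁ eq) = eq
    collapse (inj₂ eq) = trans eq single
    cover : ∀ {x} → adj G u x ≡ true → ∀ v → v ≡ u ⊎ Same x v
    cover ux v with same? u v
    ... | yes s  = inj₁ (collapse s)
    ... | no u≁v =
      let b , vb , ub = neighbour v u≁v
      in inj₂ (subst (λ z → Same z v) (unique ub ux) (same-sym vb))
    k≤2 : kOf H ≤ 2
    k≤2 with Fₚ.any? (λ x → adj G u x Boolₚ.≟ true)
    ... | no none = ℕₚ.≤-trans (ℕₚ.m∸n≤m n (edgeCount H)) (ℕₚ.≤-trans (covered⇒≤ (u ∷ []) only) (s≤s z≤n))
      where
      only : ∀ v → ∃ λ i → lookup (u ∷ []) i ≡ v
      only v with same? u v
      ... | yes s  = zero , ≡.sym (collapse s)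
      ... | no u≁v = let b , _ , ub = neighbour v u≁v in ⊥-elim (none (b , ub))
    ... | yes (x , ux) with mate x Fₚ.≟ x
    ... | yes eq = ℕₚ.≤-trans (ℕₚ.m∸n≤m n (edgeCount H)) (covered⇒≤ (u ∷ x ∷ []) two-nodes)
      where
      two-nodes : ∀ v → ∃ λ i → lookup (u ∷ x ∷ []) i ≡ v
      two-nodes v with cover ux v
      ... | inj₁ v≡u        = zero , ≡.sym v≡u
      ... | inj₂ (inj₁ v≡x) = suc zero , ≡.sym v≡x
      ... | inj₂ (inj₂ v≡m) = suc zero , ≡.sym (trans v≡m eq)
    -- At most three nodes and at least one edge of `H` leave at most two components.
    ... | no ne = ℕₚ.∸-mono {n} {3} (covered⇒≤ (u ∷ x ∷ mate x ∷ []) three-nodes)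
                    (edgeCount-pos H x (mate x) (mateOf-adj H ne))
      where
      three-nodes : ∀ v → ∃ λ i → lookup (u ∷ x ∷ mate x ∷ []) i ≡ v
      three-nodes v with cover ux v
      ... | inj₁ v≡u        = zero , ≡.sym v≡u
      ... | inj₂ (inj₁ v≡x) = suc zero , ≡.sym v≡x
      ... | inj₂ (inj₂ v≡m) = suc (suc zero) , ≡.sym v≡m

  module _ (facet : Facet (InCut (suc n)) f two) where

    -- L is given on cuts by the function ℓ of the node set separated from n+1.
    facet-vanish : ∀ {L : Vect (suc n) → ℚ} (ℓ : (Fin n → Bool) → ℚ) → IsLinear L →
      (∀ S R → (∀ u → R u ≡ separated S u) → L (cutVec S) ≡ ℓ R) →
      (∀ R → Root R → ℓ R ≡ 0ℚ) → ℓ empty ≡ 0ℚ → ∀ R → ℓ R ≡ 0ℚ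
    facet-vanish {L} ℓ hL Lℓ vanish ℓ∅ R = trans (≡.sym (Lℓ (avoid R) R (avoid-xor R)))
      (facet-unique-form {f = f} {L} f-linear hL facet
        (cut-face-vanish {f = f} f-linear f-valid {L} hL λ S fS → trans (Lℓ S (separated S) (λ _ → refl))
          (vanish (separated S) (lhsI⇒root S (separated S) (λ _ → refl) G H matching 1≤n fS)))
        origin (cutVec-inCut (avoid empty)) f-origin
        (trans (Lℓ (avoid empty) empty (avoid-xor empty)) ℓ∅)
        (cutVec (avoid R)) (cutVec-inCut (avoid R)))

    module LowDegree (u : Fin n) (mu≢u : mate u ≢ u)
      (unique : ∀ {x y} → adj G u x ≡ true → adj G u y ≡ true → x ≡ y) where

      w : Fin n
      w = mate u

      coord-w : ∀ S R → (∀ v → R v ≡ separated S v) →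
        two * coord (cutVec S) (inject₁ w) (fromℕ n) ≡ two * ind (R w)
      coord-w S R R≡ = cong (two *_) (coord-root S R R≡ w)

      node-w-u : node w u ≡ false
      node-w-u = ¬true⇒false (λ h → mu≢u (≡.sym (node-elim h)))

      w-full : ∀ R → R w ≡ true → full R w ≡ true → R u ≡ true
      w-full R Rw fw = trans (cong R (≡.sym (mateOf-mateOf H matching u))) (proj₂ (∧-split {R w} fw))

      -- In a root with w ∈ R and u ∉ R the edge from a full component to {w , u} ends in u.
      root-neighbour : ∀ R → Root R → R w ≡ true → R u ≡ false →
        ∃ λ b → R b ≡ true × adj G u b ≡ true
      root-neighbour R root Rw ¬Ru =
        let i , fi = root-full R root
            a , b , wa , ib , ab = joined {w} {i}
              (λ s → true≢false (w-full R Rw (full-same R fi (same-sym s))) ¬Ru)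
        in b , full⇒∈ R fi ib , at-u (full⇒∈ R fi ib) wa ab
        where
        at-u : ∀ {a b} → R b ≡ true → Same w a → adj G a b ≡ true → adj G u b ≡ true
        at-u Rb (inj₁ refl) ab = ⊥-elim (true≢false (w-full R Rw (root-edge R root ab Rw Rb)) ¬Ru)
        at-u {b = b} Rb (inj₂ refl) ab = subst (λ z → adj G z b ≡ true) (mateOf-mateOf H matching u) ab

      two≢0 : two ≢ 0ℚ
      two≢0 ()

      -- The form 2 x_{w,n+1} + T(w,u;n+1) takes the value 2 R_w (1 - R_u) on cuts. It vanishes on
      -- the roots, since one with R_w = 1 and R_u = 0 would contain a neighbour of `u`, but it
      -- equals 2 at the cut of `w` alone.
      ¬isolated : ¬ (∀ x → ¬ (adj G u x ≡ true))
      ¬isolated none = contra (facet-vanish ℓ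
          (linear-+ (linear-* two (linear-coord (inject₁ w) (fromℕ n))) (T-linear w u))
          (λ S R R≡ → cong₂ _+_ (coord-w S R R≡) (T-cutVec S R R≡ w u)) vanish refl (node w))
        where
        poly : Bool → Bool → ℚ
        poly p q = two * ind p + - two * ind (p ∧ q)
        ℓ : (Fin n → Bool) → ℚ
        ℓ R = poly (R w) (R u)
        value : ∀ p q → (p ≡ true → q ≢ false) → poly p q ≡ 0ℚ
        value true  true  h = refl
        value true  false h = ⊥-elim (h refl refl)
        value false q     h = refl
        vanish : ∀ R → Root R → ℓ R ≡ 0ℚ
        vanish R root = value (R w) (R u) λ Rw ¬Ru →
          let b , _ , ub = root-neighbour R root Rw ¬Ru in none b ub
        contra : ℓ (node w) ≢ 0ℚ
        contra h = two≢0 (trans (≡.sym (cong₂ poly (node-self w) node-w-u)) h)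

      -- Every root satisfies R_w (1 - R_u) (1 - R_x) = 0 by `root-neighbour` and R_u R_x (1 - R_w)
      -- = 0 by `root-edge`. Neither is linear in the cut vector, but in their sum the cubic terms
      -- cancel; `poly` is twice this sum.
      ¬leaf : ∀ {x} → ¬ (adj G u x ≡ true)
      ¬leaf {x} ux = contra (facet-vanish ℓ
          (linear-- (linear-+ (linear-+ (linear-* two (linear-coord (inject₁ w) (fromℕ n)))
            (T-linear w u)) (T-linear w x)) (T-linear u x))
          (λ S R R≡ → cong₂ _-_ (cong₂ _+_ (cong₂ _+_ (coord-w S R R≡) (T-cutVec S R R≡ w u))
            (T-cutVec S R R≡ w x)) (T-cutVec S R R≡ u x)) vanish refl (node w))
        where
        poly : Bool → Bool → Bool → ℚ
        poly p q r = two * ind p + - two * ind (p ∧ q) + - two * ind (p ∧ r) - - two * ind (q ∧ r)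
        ℓ : (Fin n → Bool) → ℚ
        ℓ R = poly (R w) (R u) (R x)
        value : ∀ p q r → (p ≡ true → q ≡ false → r ≡ true) → (q ≡ true → r ≡ true → p ≡ true) →
          poly p q r ≡ 0ℚ
        value true  true  true  h k = refl
        value true  true  false h k = refl
        value true  false true  h k = refl
        value true  false false h k with h refl refl
        ... | ()
        value false true  true  h k with k refl refl
        ... | ()
        value false true  false h k = refl
        value false false r     h k = refl
        vanish : ∀ R → Root R → ℓ R ≡ 0ℚ
        vanish R root = value (R w) (R u) (R x)
          (λ Rw ¬Ru → let b , Rb , ub = root-neighbour R root Rw ¬Ru in
            subst (λ z → R z ≡ true) (unique ub ux) Rb)
          (λ Ru Rx → proj₂ (∧-split {R u} (root-edge R root ux Ru Rx)))
        node-w-x : node w x ≡ false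
        node-w-x = ¬true⇒false (λ h → cross ux (inj₂ (node-elim h)))
        contra : ℓ (node w) ≢ 0ℚ
        contra h = two≢0 (trans (≡.sym (trans (cong₂ (λ p q → poly p q (node w x)) (node-self w) node-w-u)
                                               (cong (poly true false) node-w-x))) h)

    degree-two : 3 ≤ kOf H → ∀ u → 2 ≤ degree G u
    degree-two 3≤k u = decidable-stable (2 ℕₚ.≤? degree G u) λ low →
      let unique = λ {x} {y} (ux : adj G u x ≡ true) (uy : adj G u y ≡ true) →
            decidable-stable (x Fₚ.≟ y) (λ x≢y → low (count-two n (adj G u) x y x≢y ux uy))
          open LowDegree u (single-degree 3≤k u unique) unique
      in ¬isolated (λ x → ¬leaf)

theorem4 : (n : ℕ) → 1 ≤ n → (G H : Graph n) → Matching H → EdgeCond G H → 3 ≤ kOf H →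
    (Facet (InCut (suc n)) (lhsI G H) two ⇔ (∀ (u : Fin n) → 2 ≤ degree G u))
theorem4 n 1≤n G H matching edgeCond 3≤k = mk⇔ (λ facet → degree-two facet 3≤k) degree-two⇒facet
  where open Theorem 1≤n G H matching edgeCond
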